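{- Let $\mathcal F$ be a hereditary class of graphs. Suppose there are constants $k$ and $k'$ such that every graph in $\mathcal F$ is $k$-creature-free and, for every $G\in\mathcal F$, every minimal separator of $G$ can be dominated by a set of at most $k'$ vertices of $G$. Then $\mathcal F$ is strongly-quasi-tame.
   Context: All graphs are finite, simple and undirected. A class is hereditary if it is closed under vertex deletion (induced subgraphs). $N_G(X)$ denotes the open neighborhood of a vertex set $X$. Two disjoint vertex sets are anti-complete if there is no edge between them. A set $X\subseteq V(G)$ dominates $Y\subseteq V(G)$ if every $y\in Y$ is in $X$ or has a neighbor in $X$. Minimal separator of $G$: a non-empty $S\subseteq V(G)$ such that $G-S$ has at least two distinct connected components $L,R$ with $N_G(L)=N_G(R)=S$. A family $\mathcal F$ is strongly-quasi-tame if there is a constant $c$ such that every $G\in\mathcal F$ (with at least one vertex) has at most $|V(G)|^{c\log(|V(G)|)}$ minimal separators. $k$-creature: a tuple $(A,B,\{x_1,\dots,x_k\},\{y_1,\dots,y_k\})$ of mutually disjoint vertex subsets of $V(G)$ (with the $x_i$ distinct and the $y_i$ distinct) such that (i) $G[A]$ and $G[B]$ are connected and $A$ is anti-complete with $B$; (ii) for every $i$, $x_iy_i\in E(G)$, $x_i$ has a neighbor in $A$ and no neighbor in $B$, and $y_i$ has a neighbor in $B$ and no neighbor in $A$; (iii) for $i\ne j$, $x_iy_j\notin E(G)$. $G$ is $k$-creature-free if it contains no $k$-creature. -}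

module Defs where

open import Level using (Level; 0ℓ)
open import Data.Nat using (ℕ; _≤_; _*_; _^_)
open import Data.Nat.Logarithm using (⌊log₂_⌋)
open import Data.Fin using (Fin)
open import Data.Fin.Subset using (Subset; _∈_; _∉_; _⊆_; _∩_; ∁; ∣_∣; Empty; Nonempty)
open import Data.List using (List; length)
open import Data.List.Relation.Unary.All using (All)
open import Data.List.Relation.Unary.Unique.Propositional using (Unique)
open import Data.Product using (_×_; Σ-syntax; ∃-syntax)
open import Data.Sum using (_⊎_)
open import Function.Bundles using (_⇔_)
open import Function.Definitions using (Injective)
open import Relation.Binary using (Rel; Decidable; Symmetric; Irreflexive)
open import Relation.Binary.Construct.Closure.ReflexiveTransitive using (Star)
open import Relation.Binary.PropositionalEquality using (_≡_; _≢_)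
open import Relation.Nullary using (¬_)
open import Relation.Unary using (Pred; _≐_)

record Graph : Set₁ where
  field
    order  : ℕ
    Adj    : Rel (Fin order) 0ℓ
    adj?   : Decidable Adj
    symm   : Symmetric Adj
    irrefl : Irreflexive _≡_ Adj

  Vertex : Set
  Vertex = Fin order

  VertexSet : Set
  VertexSet = Subset order

-- H is isomorphic to an induced subgraph of G.
record _InducedIn_ (H G : Graph) : Set where
  private
    module H = Graph H
    module G = Graph G
  field
    embed     : H.Vertex → G.Vertex
    injective : Injective _≡_ _≡_ embed
    adj⇔adj   : ∀ u v → H.Adj u v ⇔ G.Adj (embed u) (embed v)

GraphClass : (ℓ : Level) → Set _
GraphClass ℓ = Pred Graph ℓ

-- Since the vertex sets are the types Fin n, graphs are considered up to
-- isomorphism: a hereditary class in this sense is in particular closed under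
-- isomorphism.
Hereditary : ∀ {ℓ} → GraphClass ℓ → Set _
Hereditary F = ∀ {G H} → F G → H InducedIn G → F H

module _ (G : Graph) where
  open Graph G

  HasNeighborIn : VertexSet → Vertex → Set
  HasNeighborIn X v = ∃[ u ] (u ∈ X × Adj v u)

  OpenNeighborhood : VertexSet → Pred Vertex 0ℓ
  OpenNeighborhood X v = v ∉ X × HasNeighborIn X v

  AntiComplete : VertexSet → VertexSet → Set
  AntiComplete X Y = ∀ {u v} → u ∈ X → v ∈ Y → ¬ Adj u v

  Dominates : VertexSet → VertexSet → Set
  Dominates X Y = ∀ {y} → y ∈ Y → y ∈ X ⊎ HasNeighborIn X y

  AdjWithin : VertexSet → Rel Vertex 0ℓ
  AdjWithin X u v = u ∈ X × v ∈ X × Adj u v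

  -- The induced subgraph G[X] is connected; connected graphs are non-empty.
  Connected : VertexSet → Set
  Connected X = Nonempty X × (∀ {u v} → u ∈ X → v ∈ X → Star (AdjWithin X) u v)

  -- L is the vertex set of a connected component of G − S, i.e. an
  -- inclusion-maximal connected subset of V(G) ∖ S.
  record ComponentOfDeletion (S L : VertexSet) : Set where
    field
      avoids    : L ⊆ ∁ S
      connected : Connected L
      maximal   : ∀ {M} → M ⊆ ∁ S → Connected M → L ⊆ M → M ⊆ L

  record MinimalSeparator (S : VertexSet) : Set where
    field
      nonempty   : Nonempty S
      L R        : VertexSet
      L≢R        : L ≢ R
      componentL : ComponentOfDeletion S L
      componentR : ComponentOfDeletion S R
      N[L]≐S     : OpenNeighborhood L ≐ (_∈ S)
      N[R]≐S     : OpenNeighborhood R ≐ (_∈ S)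

  record Creature (k : ℕ) : Set where
    field
      A B : VertexSet
      x y : Fin k → Vertex

      x-injective : Injective _≡_ _≡_ x
      y-injective : Injective _≡_ _≡_ y
      A∩B-empty   : Empty (A ∩ B)
      x∉A         : ∀ i → x i ∉ A
      x∉B         : ∀ i → x i ∉ B
      y∉A         : ∀ i → y i ∉ A
      y∉B         : ∀ i → y i ∉ B
      x≢y         : ∀ i j → x i ≢ y j

      A-connected    : Connected A
      B-connected    : Connected B
      A-anticomplete : AntiComplete A B

      xy-adjacent : ∀ i → Adj (x i) (y i)
      x-near-A    : ∀ i → HasNeighborIn A (x i)
      x-far-B     : ∀ i → ¬ HasNeighborIn B (x i)
      y-near-B    : ∀ i → HasNeighborIn B (y i)
      y-far-A     : ∀ i → ¬ HasNeighborIn A (y i)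

      xy-nonadjacent : ∀ {i j} → i ≢ j → ¬ Adj (x i) (y j)

  CreatureFree : ℕ → Set
  CreatureFree k = ¬ Creature k

  SeparatorsDominatedBy : ℕ → Set
  SeparatorsDominatedBy k′ =
    ∀ {S} → MinimalSeparator S → Σ[ X ∈ VertexSet ] (∣ X ∣ ≤ k′ × Dominates X S)

-- At most m elements satisfy P: every list of pairwise distinct elements
-- satisfying P has length at most m.
AtMost : ∀ {a p} {A : Set a} → ℕ → Pred A p → Set _
AtMost {A = A} m P = (xs : List A) → Unique xs → All P xs → length xs ≤ m

-- The base and the rounding of the logarithm are absorbed by the constant c:
-- ⌊log₂ n⌋ ≤ log₂ n ≤ 2 ⌊log₂ n⌋ for n ≥ 2, and both sides vanish for n = 1.
-- Likewise a real constant c may be rounded up to a natural number.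
StronglyQuasiTame : ∀ {ℓ} → GraphClass ℓ → Set _
StronglyQuasiTame F =
  ∃[ c ] (∀ G → F G → let n = Graph.order G in
    1 ≤ n → AtMost (n ^ (c * ⌊log₂ n ⌋)) (MinimalSeparator G))

{-# OPTIONS --safe #-}
-- A minimal separator S with full components L ∋ ℓ and R ∋ r is located by
-- guessing. Keep vs ⊆ L, ws ⊆ R, a set Z disjoint from L ∪ R and a set U with
-- S ⊆ Z ∪ N[vs] ∪ N[ws] ∪ U. Call v heavy if N[v] contains a constant fraction
-- of U. If L or R contains a heavy vertex, guess it and remove its neighbourhood
-- from U. Otherwise the heavy vertices may be added to Z; without them S is still
-- a minimal separator, hence dominated by k′ vertices that are not heavy, so that
-- guessing these at least halves U. After O(log n) guesses U is empty.
--
-- Now the set M of vertices outside Z ∪ N[vs] ∪ N[ws] avoids S. First, two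
-- vertices of L at a time attach a new element of vs to the part of L reached
-- from ℓ through M.
-- Once this part contains vs, every vertex of L is reached with the help of one
-- more vertex of L. A minimal set W of such helpers reaching a neighbour of every
-- vertex of S has private neighbours in S, which together with subwalks in L and
-- with R would form a k-creature if |W| > k. So O(k + log n) vertices of L
-- determine S ∩ N[ws], hence R as the component of r, hence S = N(R).

module Submission where

open import Defs
open import Level using (Level; 0ℓ)
open import Data.Fin using (Fin; zero; suc; inject≤)
open import Data.Fin.Properties using (_≟_; any?; all?; ¬∀⟶∃¬; suc-injective; inject≤-injective)
open import Data.Fin.Subset
  using (Subset; inside; outside; _∈_; _∉_; _⊆_; _∪_; _∩_; _─_; _-_; ∁; ⊤; ⊥; ⁅_⁆; ∣_∣; Nonempty)
open import Data.Fin.Subset.Properties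
  using (_∈?_; ∣⊤∣≡n; ∉⊥; ∣⊥∣≡0; ∣⁅x⁆∣≡1; ∈⊤; x∈p∩q⁺; x∈p∩q⁻; x∈p∪q⁺; x∈p∪q⁻;
         x∈p∧x∉q⇒x∈p─q; p─q⊆p; x∈⁅x⁆; x∈p∧x≢y⇒x∈p-y; x∈p⇒∣p-x∣<∣p∣; ⊆-antisym;
         p⊆q⇒∣p∣≤∣q∣; x∈∁p⇒x∉p; x∉p⇒x∈∁p)
open import Data.List using (List; []; _∷_; _++_; length; map; replicate)
open import Data.List.Membership.Propositional using (find; lose) renaming (_∈_ to _∈ˡ_)
open import Data.List.Membership.Propositional.Properties using (∈-++⁺ˡ; ∈-++⁺ʳ; ∈-map⁺; ∈-map⁻)
open import Data.List.Properties using (length-++; length-map; length-replicate)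
open import Data.List.Relation.Binary.Sublist.Propositional
  using ([]; _∷_; _∷ʳ_) renaming (_⊆_ to _⊑_)
open import Data.List.Relation.Binary.Sublist.Propositional.Properties using (All-resp-⊆)
open import Data.List.Relation.Unary.All using (All; []; _∷_)
import Data.List.Relation.Unary.All as All
open import Data.List.Relation.Unary.All.Properties using (¬All⇒Any¬) renaming (++⁺ to All-++⁺)
open import Data.List.Relation.Unary.AllPairs using ([]; _∷_)
open import Data.List.Relation.Unary.Any using (Any; here; there)
import Data.List.Relation.Unary.Any as Any
open import Data.List.Relation.Unary.Unique.Propositional using (Unique)
open import Data.Nat
  using (ℕ; zero; suc; _+_; _*_; _^_; _∸_; _≤_; _<_; z≤n; s≤s; _≤?_; pred; NonZero; >-nonZero)
open import Data.Nat.Logarithm using (⌊log₂_⌋; ⌊log₂⌋-mono-≤; ⌊log₂[2^n]⌋≡n)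
open import Data.Nat.Properties hiding (_≟_; suc-injective)
open import Data.Nat.Solver using (module +-*-Solver)
open import Data.Product using (_×_; _,_; proj₁; proj₂; ∃₂; Σ-syntax; ∃-syntax)
open import Data.Sum using (_⊎_; inj₁; inj₂; [_,_])
import Data.Sum as Sum
open import Data.Vec using ([]; _∷_; tabulate)
import Data.Vec as Vec
open import Data.Vec.Properties using (lookup∘tabulate; []=⇒lookup; lookup⇒[]=)
open import Function using (_∘_; id)
open import Function.Bundles using (mk⇔)
open import Function.Definitions using (Injective)
open import Relation.Binary.Construct.Closure.ReflexiveTransitive using (Star; ε; _◅_; _◅◅_; reverse)
open import Relation.Binary.PropositionalEquality
  using (_≡_; _≢_; refl; sym; trans; cong; subst)
open import Relation.Nullary using (¬_; Dec; yes; no; contradiction; does)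
open import Relation.Nullary.Decidable using (_×-dec_; _⊎-dec_; _→-dec_; ¬?; map′; dec-true)
open import Relation.Binary using (Rel)
open import Relation.Unary using (Pred; Decidable; _≐_) renaming (_∪_ to _∪ᵖ_)

-- Counting elements of a predicate

module _ {a} {A : Set a} where

  atMost-map : ∀ {p q m} {P : Pred A p} {Q : Pred A q} → (∀ {x} → P x → Q x) → AtMost m Q → AtMost m P
  atMost-map P⊆Q h xs xs! ps = h xs xs! (All.map P⊆Q ps)

  atMost-mono : ∀ {p m n} {P : Pred A p} → m ≤ n → AtMost m P → AtMost n P
  atMost-mono m≤n h xs xs! ps = ≤-trans (h xs xs! ps) m≤n

  -- The empty list needs no bound, and the head of any other list supplies the witness of `B`.
  atMost-given : ∀ {p b m} {B : Set b} {P : Pred A p} → (B → AtMost m P) → AtMost m (λ x → B × P x)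
  atMost-given h []       _   _                  = z≤n
  atMost-given h (x ∷ xs) xs! ps@((b , _) ∷ _) = h b (x ∷ xs) xs! (All.map proj₂ ps)

  atMost-subsingleton : ∀ {p} {P : Pred A p} → (∀ {x y} → P x → P y → x ≡ y) → AtMost 1 P
  atMost-subsingleton h []           _              _            = z≤n
  atMost-subsingleton h (x ∷ [])     _              _            = s≤s z≤n
  atMost-subsingleton h (x ∷ y ∷ xs) ((x≢y ∷ _) ∷ _) (px ∷ py ∷ _) = contradiction (h px py) x≢y

  unique-⊑ : ∀ {xs ys : List A} → ys ⊑ xs → Unique xs → Unique ys
  unique-⊑ []         _          = []
  unique-⊑ (_ ∷ʳ τ)   (_ ∷ xs!)  = unique-⊑ τ xs!
  unique-⊑ (refl ∷ τ) (x∉ ∷ xs!) = All-resp-⊆ τ x∉ ∷ unique-⊑ τ xs!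

  -- Sublists, rather than arbitrary lists, are produced so that both parts inherit uniqueness.
  split-⊎ : ∀ {p q} {P : Pred A p} {Q : Pred A q} {xs} → All (P ∪ᵖ Q) xs →
            ∃₂ λ ys zs → ys ⊑ xs × zs ⊑ xs × All P ys × All Q zs × length xs ≡ length ys + length zs
  split-⊎ [] = [] , [] , [] , [] , [] , [] , refl
  split-⊎ {xs = x ∷ _} (inj₁ p ∷ pqs) with split-⊎ pqs
  ... | ys , zs , σ , τ , ps , qs , eq =
    x ∷ ys , zs , refl ∷ σ , x ∷ʳ τ , p ∷ ps , qs , cong suc eq
  split-⊎ {xs = x ∷ _} (inj₂ q ∷ pqs) with split-⊎ pqs
  ... | ys , zs , σ , τ , ps , qs , eq =
    ys , x ∷ zs , x ∷ʳ σ , refl ∷ τ , ps , q ∷ qs , trans (cong suc eq) (sym (+-suc _ _))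

  atMost-⊎ : ∀ {p q m n} {P : Pred A p} {Q : Pred A q} →
             AtMost m P → AtMost n Q → AtMost (m + n) (P ∪ᵖ Q)
  atMost-⊎ hP hQ xs xs! pqs with split-⊎ pqs
  ... | ys , zs , σ , τ , ps , qs , eq =
    subst (_≤ _) (sym eq) (+-mono-≤ (hP ys (unique-⊑ σ xs!) ps) (hQ zs (unique-⊑ τ xs!) qs))

  atMost-∃ : ∀ {n m p} {P : Fin n → Pred A p} →
             (∀ i → AtMost m (P i)) → AtMost (n * m) (λ x → ∃[ i ] P i x)
  atMost-∃ {zero}  h []      _   _               = z≤n
  atMost-∃ {zero}  h (_ ∷ _) _   ((() , _) ∷ _)
  atMost-∃ {suc n} {P = P} h = atMost-map
    (λ { (zero , q) → inj₁ q ; (suc i , q) → inj₂ (i , q) })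
    (atMost-⊎ (h zero) (atMost-∃ {P = P ∘ suc} (h ∘ suc)))

  atMost-∃-list : ∀ {n m p} k {P : List (Fin n) → Pred A p} → (∀ is → AtMost m (P is)) →
                  AtMost (n ^ k * m) (λ x → ∃[ is ] (length is ≡ k × P is x))
  atMost-∃-list {n} {m} zero {P} h = atMost-map
    (λ { ([] , _ , q) → q }) (atMost-mono (≤-reflexive (sym (+-identityʳ m))) (h []))
  atMost-∃-list {n} {m} (suc k) {P} h = atMost-map
    (λ { (i ∷ is , eq , q) → i , is , cong pred eq , q })
    (atMost-mono (≤-reflexive (sym (*-assoc n (n ^ k) m)))
      (atMost-∃ {P = λ i x → ∃[ is ] (length is ≡ k × P (i ∷ is) x)}
        (λ i → atMost-∃-list k {P = λ is → P (i ∷ is)} (λ is → h (i ∷ is)))))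

-- Guesses are counted as lists of one exact length, so shorter lists are filled up with copies of
-- `d`.
padTo : ∀ {a} {A : Set a} → ℕ → A → List A → List A
padTo k d xs = xs ++ replicate (k ∸ length xs) d

module _ {a} {A : Set a} {k : ℕ} {d : A} where

  length-padTo : ∀ {xs} → length xs ≤ k → length (padTo k d xs) ≡ k
  length-padTo {xs} l≤k = trans (length-++ xs)
    (trans (cong (length xs +_) (length-replicate (k ∸ length xs))) (m+[n∸m]≡n l≤k))

  ∈-padTo⁺ : ∀ {xs x} → x ∈ˡ xs → x ∈ˡ padTo k d xs
  ∈-padTo⁺ = ∈-++⁺ˡ

  all-padTo : ∀ {p} {P : Pred A p} {xs} → P d → All P xs → All P (padTo k d xs)
  all-padTo {P = P} {xs = xs} pd ps = go ps (k ∸ length xs)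
    where
    go : ∀ {xs} → All P xs → ∀ m → All P (xs ++ replicate m d)
    go []       zero    = []
    go []       (suc m) = pd ∷ go [] m
    go (p ∷ ps) m       = p ∷ go ps m

-- Finite sets

module _ {n : ℕ} {p} {P : Pred (Fin n) p} (P? : Decidable P) where

  ⟪_⟫ : Subset n
  ⟪_⟫ = tabulate (does ∘ P?)

  ∈-⟪⟫⁺ : ∀ {x} → P x → x ∈ ⟪_⟫
  ∈-⟪⟫⁺ {x} px = lookup⇒[]= x _ (trans (lookup∘tabulate _ x) (dec-true (P? x) px))

  ∈-⟪⟫⁻ : ∀ {x} → x ∈ ⟪_⟫ → P x
  ∈-⟪⟫⁻ {x} x∈ with P? x | trans (sym (lookup∘tabulate (does ∘ P?) x)) ([]=⇒lookup x∈)
  ... | yes px | _ = px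
  ... | no  _  | ()

x∈p─q⇒x∉q : ∀ {n} {p q : Subset n} {x} → x ∈ p ─ q → x ∉ q
x∈p─q⇒x∉q {p = _ ∷ p} {inside ∷ q} {suc x} (Vec.there x∈) (Vec.there x∈q) = x∈p─q⇒x∉q {p = p} x∈ x∈q
x∈p─q⇒x∉q {p = _ ∷ p} {outside ∷ q} {suc x} (Vec.there x∈) (Vec.there x∈q) = x∈p─q⇒x∉q {p = p} x∈ x∈q

∣p∪q∣≤∣p∣+∣q∣ : ∀ {n} (p q : Subset n) → ∣ p ∪ q ∣ ≤ ∣ p ∣ + ∣ q ∣
∣p∪q∣≤∣p∣+∣q∣ []            []            = z≤n
∣p∪q∣≤∣p∣+∣q∣ (outside ∷ p) (outside ∷ q) = ∣p∪q∣≤∣p∣+∣q∣ p q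
∣p∪q∣≤∣p∣+∣q∣ (outside ∷ p) (inside ∷ q)  =
  subst (suc ∣ p ∪ q ∣ ≤_) (sym (+-suc ∣ p ∣ ∣ q ∣)) (s≤s (∣p∪q∣≤∣p∣+∣q∣ p q))
∣p∪q∣≤∣p∣+∣q∣ (inside ∷ p)  (outside ∷ q) = s≤s (∣p∪q∣≤∣p∣+∣q∣ p q)
∣p∪q∣≤∣p∣+∣q∣ (inside ∷ p)  (inside ∷ q)  = s≤s (≤-trans (∣p∪q∣≤∣p∣+∣q∣ p q) (+-monoʳ-≤ ∣ p ∣ (n≤1+n ∣ q ∣)))

∣p∩q∣+∣p─q∣≡∣p∣ : ∀ {n} (p q : Subset n) → ∣ p ∩ q ∣ + ∣ p ─ q ∣ ≡ ∣ p ∣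
∣p∩q∣+∣p─q∣≡∣p∣ []            []            = refl
∣p∩q∣+∣p─q∣≡∣p∣ (outside ∷ p) (outside ∷ q) = ∣p∩q∣+∣p─q∣≡∣p∣ p q
∣p∩q∣+∣p─q∣≡∣p∣ (outside ∷ p) (inside ∷ q)  = ∣p∩q∣+∣p─q∣≡∣p∣ p q
∣p∩q∣+∣p─q∣≡∣p∣ (inside ∷ p)  (outside ∷ q) = trans (+-suc ∣ p ∩ q ∣ ∣ p ─ q ∣) (cong suc (∣p∩q∣+∣p─q∣≡∣p∣ p q))
∣p∩q∣+∣p─q∣≡∣p∣ (inside ∷ p)  (inside ∷ q)  = cong suc (∣p∩q∣+∣p─q∣≡∣p∣ p q)

elems : ∀ {n} → Subset n → List (Fin n)
elems []            = []
elems (outside ∷ p) = map suc (elems p)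
elems (inside ∷ p)  = zero ∷ map suc (elems p)

length-elems : ∀ {n} (p : Subset n) → length (elems p) ≡ ∣ p ∣
length-elems []            = refl
length-elems (outside ∷ p) = trans (length-map suc (elems p)) (length-elems p)
length-elems (inside ∷ p)  = cong suc (trans (length-map suc (elems p)) (length-elems p))

∈-elems⁺ : ∀ {n} {p : Subset n} {x} → x ∈ p → x ∈ˡ elems p
∈-elems⁺ {p = inside ∷ p}  Vec.here       = here refl
∈-elems⁺ {p = inside ∷ p}  (Vec.there x∈) = there (∈-map⁺ suc (∈-elems⁺ x∈))
∈-elems⁺ {p = outside ∷ p} (Vec.there x∈) = ∈-map⁺ suc (∈-elems⁺ x∈)

∈-elems⁻ : ∀ {n} {p : Subset n} {x} → x ∈ˡ elems p → x ∈ p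
∈-elems⁻ {p = inside ∷ p}  (here refl) = Vec.here
∈-elems⁻ {p = inside ∷ p}  (there x∈) with ∈-map⁻ suc x∈
... | _ , y∈ , refl = Vec.there (∈-elems⁻ y∈)
∈-elems⁻ {p = outside ∷ p} x∈ with ∈-map⁻ suc x∈
... | _ , y∈ , refl = Vec.there (∈-elems⁻ y∈)

enum : ∀ {n} (p : Subset n) → Fin ∣ p ∣ → Fin n
enum (outside ∷ p) i       = suc (enum p i)
enum (inside ∷ p)  zero    = zero
enum (inside ∷ p)  (suc i) = suc (enum p i)

enum-injective : ∀ {n} (p : Subset n) → Injective _≡_ _≡_ (enum p)
enum-injective (outside ∷ p) {i} {j} eq = enum-injective p (suc-injective eq)
enum-injective (inside ∷ p) {zero} {zero} eq = refl
enum-injective (inside ∷ p) {suc i} {suc j} eq = cong suc (enum-injective p (suc-injective eq))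

enum-∈ : ∀ {n} (p : Subset n) i → enum p i ∈ p
enum-∈ (outside ∷ p) i       = Vec.there (enum-∈ p i)
enum-∈ (inside ∷ p)  zero    = Vec.here
enum-∈ (inside ∷ p)  (suc i) = Vec.there (enum-∈ p i)

enum-surjective : ∀ {n} (p : Subset n) {x} → x ∈ p → ∃[ i ] enum p i ≡ x
enum-surjective (outside ∷ p) (Vec.there x∈) with enum-surjective p x∈
... | i , refl = i , refl
enum-surjective (inside ∷ p) Vec.here = zero , refl
enum-surjective (inside ∷ p) (Vec.there x∈) with enum-surjective p x∈
... | i , refl = suc i , refl

fromList : ∀ {n} → List (Fin n) → Subset n
fromList []       = ⊥
fromList (x ∷ xs) = ⁅ x ⁆ ∪ fromList xs

∈-fromList⁺ : ∀ {n} {xs : List (Fin n)} {x} → x ∈ˡ xs → x ∈ fromList xs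
∈-fromList⁺ {xs = x ∷ xs} (here refl) = x∈p∪q⁺ (inj₁ (x∈⁅x⁆ x))
∈-fromList⁺ {xs = x ∷ xs} (there x∈)  = x∈p∪q⁺ (inj₂ (∈-fromList⁺ x∈))

∣fromList∣≤length : ∀ {n} (xs : List (Fin n)) → ∣ fromList xs ∣ ≤ length xs
∣fromList∣≤length {n} []   = ≤-reflexive (∣⊥∣≡0 n)
∣fromList∣≤length (x ∷ xs) = ≤-trans (∣p∪q∣≤∣p∣+∣q∣ ⁅ x ⁆ (fromList xs))
  (+-mono-≤ (≤-reflexive (∣⁅x⁆∣≡1 x)) (∣fromList∣≤length xs))

-- Greedy deletion of single elements; minimality is accordingly claimed for single deletions only.
minimal-subset : ∀ {n p} {P : Pred (Subset n) p} → Decidable P → ∀ X → P X →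
                 ∃[ Y ] (Y ⊆ X × P Y × (∀ {y} → y ∈ Y → ¬ P (Y - y)))
minimal-subset {P = P} P? X pX = go ∣ X ∣ X ≤-refl pX
  where
  go : ∀ m X → ∣ X ∣ ≤ m → P X → ∃[ Y ] (Y ⊆ X × P Y × (∀ {y} → y ∈ Y → ¬ P (Y - y)))
  go m X ∣X∣≤m pX with any? (λ y → y ∈? X ×-dec P? (X - y))
  ... | no ¬∃ = X , id , pX , λ y∈X p → ¬∃ (_ , y∈X , p)
  ... | yes (y , y∈X , p) with m | ≤-trans (x∈p⇒∣p-x∣<∣p∣ y∈X) ∣X∣≤m
  ...   | suc m | s≤s ∣X-y∣≤m with go m (X - y) ∣X-y∣≤m p
  ...     | Y , Y⊆ , rest = Y , p─q⊆p X ⁅ y ⁆ ∘ Y⊆ , rest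

-- Separations and creatures

module _ (G : Graph) where
  open Graph G

  -- Only the vertices after the start have to satisfy `X`.
  data Reach (X : Pred Vertex 0ℓ) (s : Vertex) : Vertex → Set where
    start : Reach X s s
    step  : ∀ {u v} → Reach X s u → Adj u v → X v → Reach X s v

  -- A separator with two full components, whose maximality is expressed by `N[L]⊆S` and `N[R]⊆S`.
  -- In this form it passes easily to induced subgraphs.
  record Separation (S L R : VertexSet) : Set where
    field
      L-connected : Connected G L
      R-connected : Connected G R
      L∩R-empty   : ∀ {u} → u ∈ L → u ∉ R
      L∩S-empty   : ∀ {u} → u ∈ L → u ∉ S
      R∩S-empty   : ∀ {u} → u ∈ R → u ∉ S
      N[L]⊆S      : ∀ {u v} → u ∈ L → Adj u v → v ∈ L ⊎ v ∈ S
      N[R]⊆S      : ∀ {u v} → u ∈ R → Adj u v → v ∈ R ⊎ v ∈ S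
      S⊆N[L]      : ∀ {s} → s ∈ S → HasNeighborIn G L s
      S⊆N[R]      : ∀ {s} → s ∈ S → HasNeighborIn G R s

    L-anticomplete-R : ∀ {u v} → u ∈ L → v ∈ R → ¬ Adj u v
    L-anticomplete-R u∈L v∈R uv with N[L]⊆S u∈L uv
    ... | inj₁ v∈L = L∩R-empty v∈L v∈R
    ... | inj₂ v∈S = R∩S-empty v∈R v∈S

  Near : Rel Vertex 0ℓ
  Near u v = u ≡ v ⊎ Adj u v

  near? : ∀ u v → Dec (Near u v)
  near? u v = u ≟ v ⊎-dec adj? u v

  NearAny : List Vertex → Pred Vertex 0ℓ
  NearAny vs u = Any (Near u) vs

  nearAny? : ∀ vs → Decidable (NearAny vs)
  nearAny? vs u = Any.any? (near? u) vs

module _ {G : Graph} where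
  open Graph G

  reach-fold : ∀ {X P : Pred Vertex 0ℓ} {s} → P s → (∀ {u v} → P u → Adj u v → X v → P v) →
               ∀ {u} → Reach G X s u → P u
  reach-fold p₀ p₊ start          = p₀
  reach-fold {P = P} p₀ p₊ (step r uv xv) = p₊ (reach-fold {P = P} p₀ p₊ r) uv xv

  reach-map : ∀ {X Y : Pred Vertex 0ℓ} {s} → (∀ {v} → X v → Y v) → ∀ {u} → Reach G X s u → Reach G Y s u
  reach-map X⊆Y = reach-fold start (λ r uv xv → step r uv (X⊆Y xv))

  -- Every vertex of the walk is itself reached, so what holds for all reached vertices may be
  -- imposed on the walk.
  reach-refine : ∀ {X Y : Pred Vertex 0ℓ} {s} → (∀ {v} → Reach G X s v → Y v) →
                 ∀ {u} → Reach G X s u → Reach G Y s u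
  reach-refine h start          = start
  reach-refine h (step r uv xv) = step (reach-refine h r) uv (h (step r uv xv))

  -- Graph search: once no unvisited vertex of `X` has a visited neighbour, a walk from `s` cannot
  -- leave the visited set.
  reach? : ∀ {X : Pred Vertex 0ℓ} → Decidable X → ∀ s → Decidable (Reach G X s)
  reach? {X} X? s with go order (⊤ - s) ∣⊤-s∣≤n (s∉p-s ⊤) outside-reached
    where
    s∉p-s : ∀ p → s ∉ p - s
    s∉p-s p s∈ = x∈p─q⇒x∉q {p = p} s∈ (x∈⁅x⁆ s)

    ∣⊤-s∣≤n : ∣ ⊤ - s ∣ ≤ order
    ∣⊤-s∣≤n = subst (∣ ⊤ - s ∣ ≤_) (∣⊤∣≡n order) (p⊆q⇒∣p∣≤∣q∣ (p─q⊆p ⊤ ⁅ s ⁆))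

    outside-reached : ∀ {u} → u ∉ ⊤ - s → Reach G X s u
    outside-reached {u} u∉ with u ≟ s
    ... | yes refl = start
    ... | no  u≢s  = contradiction (x∈p∧x≢y⇒x∈p-y ∈⊤ u≢s) u∉

    Closed : Subset order → Set
    Closed D = ∀ {u v} → u ∉ D → Adj u v → X v → v ∉ D

    -- D is the set of vertices that have not been visited yet.
    go : ∀ m D → ∣ D ∣ ≤ m → s ∉ D → (∀ {u} → u ∉ D → Reach G X s u) →
         ∃[ D ] (s ∉ D × (∀ {u} → u ∉ D → Reach G X s u) × Closed D)
    go m D ∣D∣≤m s∉D reached
      with any? (λ v → v ∈? D ×-dec (X? v ×-dec any? (λ u → ¬? (u ∈? D) ×-dec adj? u v)))
    ... | no ¬∃ = D , s∉D , reached , λ u∉D uv xv v∈D → ¬∃ (_ , v∈D , xv , _ , u∉D , uv)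
    ... | yes (v , v∈D , xv , u , u∉D , uv) with m | ≤-trans (x∈p⇒∣p-x∣<∣p∣ v∈D) ∣D∣≤m
    ...   | suc m | s≤s le = go m (D - v) le (s∉D ∘ p─q⊆p D ⁅ v ⁆) reached′
      where
      reached′ : ∀ {w} → w ∉ D - v → Reach G X s w
      reached′ {w} w∉ with w ≟ v
      ... | yes refl = step (reached u∉D) uv xv
      ... | no  w≢v  = reached (λ w∈D → w∉ (x∈p∧x≢y⇒x∈p-y w∈D w≢v))
  ... | D , s∉D , reached , closed = λ u → map′
    reached (reach-fold {P = _∉ D} s∉D closed) (¬? (u ∈? D))

  connected-fold : ∀ {L} {P : Pred Vertex 0ℓ} → (∀ {u v} → P u → Adj u v → u ∈ L → v ∈ L → P v) →
                   ∀ {u v} → P u → Star (AdjWithin G L) u v → P v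
  connected-fold h p ε                        = p
  connected-fold {P = P} h p ((u∈ , v∈ , uv) ◅ w) = connected-fold {P = P} h (h p uv u∈ v∈) w

  reach-connected : ∀ {X : Pred Vertex 0ℓ} (X? : Decidable X) s → Connected G ⟪ reach? X? s ⟫
  reach-connected {X} X? s =
    (s , ∈-⟪⟫⁺ (reach? X? s) start) ,
    λ u∈ v∈ → reverse (λ (a , b , ab) → b , a , symm ab) (walk (∈-⟪⟫⁻ (reach? X? s) u∈))
              ◅◅ walk (∈-⟪⟫⁻ (reach? X? s) v∈)
    where
    walk : ∀ {u} → Reach G X s u → Star (AdjWithin G ⟪ reach? X? s ⟫) s u
    walk start           = ε
    walk (step r uv xv) =
      walk r ◅◅ ((∈-⟪⟫⁺ (reach? X? s) r , ∈-⟪⟫⁺ (reach? X? s) (step r uv xv) , uv) ◅ ε)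

  -- The sides are disjoint because a walk in one component avoids `S`: if it starts in the other,
  -- it stays there, and the two would coincide.
  minimalSeparator⇒separation : ∀ {S} → MinimalSeparator G S → ∃₂ (Separation G S)
  minimalSeparator⇒separation {S} ms = L , R , record
    { L-connected = connected componentL
    ; R-connected = connected componentR
    ; L∩R-empty   = λ u∈L u∈R → L≢R (⊆-antisym
        (absorb N[R]≐S componentL u∈R u∈L) (absorb N[L]≐S componentR u∈L u∈R))
    ; L∩S-empty   = x∈∁p⇒x∉p ∘ avoids componentL
    ; R∩S-empty   = x∈∁p⇒x∉p ∘ avoids componentR
    ; N[L]⊆S      = neighbours N[L]≐S
    ; N[R]⊆S      = neighbours N[R]≐S
    ; S⊆N[L]      = proj₂ ∘ proj₂ N[L]≐S
    ; S⊆N[R]      = proj₂ ∘ proj₂ N[R]≐S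
    }
    where
    open MinimalSeparator ms
    open ComponentOfDeletion

    neighbours : ∀ {C} → OpenNeighborhood G C ≐ (_∈ S) → ∀ {u v} → u ∈ C → Adj u v → v ∈ C ⊎ v ∈ S
    neighbours {C} N≐S {v = v} u∈C uv with v ∈? C
    ... | yes v∈C = inj₁ v∈C
    ... | no  v∉C = inj₂ (proj₁ N≐S (v∉C , _ , u∈C , symm uv))

    absorb : ∀ {C D} → OpenNeighborhood G C ≐ (_∈ S) → ComponentOfDeletion G S D →
             ∀ {u} → u ∈ C → u ∈ D → D ⊆ C
    absorb {C} {D} N≐S compD u∈C u∈D v∈D = connected-fold {P = _∈ C}
      (λ a∈C ab _ b∈D →
        [ id , (λ b∈S → contradiction b∈S (x∈∁p⇒x∉p (avoids compD b∈D))) ] (neighbours N≐S a∈C ab))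
      u∈C (proj₂ (connected compD) u∈D v∈D)

  separation⇒minimalSeparator : ∀ {S L R} → Nonempty S → Separation G S L R → MinimalSeparator G S
  separation⇒minimalSeparator {S} {L} {R} S≢∅ sep = record
    { nonempty   = S≢∅
    ; L          = L
    ; R          = R
    ; L≢R        = λ { refl → let (_ , u∈L) = proj₁ L-connected in L∩R-empty u∈L u∈L }
    ; componentL = component L-connected L∩S-empty N[L]⊆S
    ; componentR = component R-connected R∩S-empty N[R]⊆S
    ; N[L]≐S     = (λ { (v∉L , _ , u∈L , vu) → [ (λ v∈L → contradiction v∈L v∉L) , id ] (N[L]⊆S u∈L (symm vu)) })
                 , λ s∈S → (λ s∈L → L∩S-empty s∈L s∈S) , S⊆N[L] s∈S
    ; N[R]≐S     = (λ { (v∉R , _ , u∈R , vu) → [ (λ v∈R → contradiction v∈R v∉R) , id ] (N[R]⊆S u∈R (symm vu)) })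
                 , λ s∈S → (λ s∈R → R∩S-empty s∈R s∈S) , S⊆N[R] s∈S
    }
    where
    open Separation sep

    component : ∀ {C} → Connected G C → (∀ {u} → u ∈ C → u ∉ S) →
                (∀ {u v} → u ∈ C → Adj u v → v ∈ C ⊎ v ∈ S) → ComponentOfDeletion G S C
    component {C} conn C∩S N⊆S = record
      { avoids    = x∉p⇒x∈∁p ∘ C∩S
      ; connected = conn
      -- A walk in `M` can leave `C` only through `S`, which `M` avoids.
      ; maximal   = λ M⊆∁S connM C⊆M v∈M → connected-fold {P = _∈ C}
          (λ a∈C ab _ b∈M →
            [ id , (λ b∈S → contradiction b∈S (x∈∁p⇒x∉p (M⊆∁S b∈M))) ] (N⊆S a∈C ab))
          (proj₂ (proj₁ conn)) (proj₂ connM (C⊆M (proj₂ (proj₁ conn))) v∈M)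
      }

  -- A is the part of L that can be reached from ℓ without meeting a neighbour
  -- of any y i, B is R, and x i is the first neighbour of y i on a walk from ℓ.
  separation⇒creature : ∀ {S L R k ℓ} → Separation G S L R → ℓ ∈ L →
    (y : Fin k → Vertex) → Injective _≡_ _≡_ y → (∀ i → y i ∈ S) → (∀ i → ¬ Adj ℓ (y i)) →
    (∀ i → ∃[ u ] (Reach G (λ v → v ∈ L × (∀ j → j ≢ i → ¬ Adj v (y j))) ℓ u × Adj u (y i))) →
    Creature G k
  separation⇒creature {S} {L} {R} {k} {ℓ} sep ℓ∈L y y-injective y∈S ℓ-far reaches = record
    { A              = ⟪ free-reach? ⟫
    ; B              = R
    ; x              = x
    ; y              = y
    ; x-injective    = λ {i} {j} xi≡xj → private-x i j (subst (λ v → Adj v (y j)) (sym xi≡xj) (x~y j))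
    ; y-injective    = y-injective
    ; A∩B-empty      = λ (u , u∈) → let (u∈A , u∈R) = x∈p∩q⁻ _ R u∈ in L∩R-empty (A⊆L u∈A) u∈R
    ; x∉A            = λ i x∈A → A-far i x∈A (x~y i)
    ; x∉B            = λ i → L∩R-empty (x∈L i)
    ; y∉A            = λ i y∈A → L∩S-empty (A⊆L y∈A) (y∈S i)
    ; y∉B            = λ i y∈R → R∩S-empty y∈R (y∈S i)
    ; x≢y            = λ i j xi≡yj → L∩S-empty (x∈L i) (subst (_∈ S) (sym xi≡yj) (y∈S j))
    ; A-connected    = reach-connected free? ℓ
    ; B-connected    = R-connected
    ; A-anticomplete = λ u∈A → L-anticomplete-R (A⊆L u∈A)
    ; xy-adjacent    = x~y
    ; x-near-A       = λ i → let (a , ra , ax) = proj₂ (proj₂ (proj₂ (hit i)))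
                             in a , ∈-⟪⟫⁺ free-reach? ra , symm ax
    ; x-far-B        = λ i (b , b∈R , xb) → L-anticomplete-R (x∈L i) b∈R xb
    ; y-near-B       = λ i → S⊆N[R] (y∈S i)
    ; y-far-A        = λ i (a , a∈A , ya) → A-far i a∈A (symm ya)
    ; xy-nonadjacent = λ {i} {j} i≢j xy → i≢j (private-x i j xy)
    }
    where
    open Separation sep

    Good : Fin k → Pred Vertex 0ℓ
    Good i v = v ∈ L × (∀ j → j ≢ i → ¬ Adj v (y j))

    Free : Pred Vertex 0ℓ
    Free v = v ∈ L × (∀ j → ¬ Adj v (y j))

    free? : Decidable Free
    free? v = v ∈? L ×-dec all? (λ j → ¬? (adj? v (y j)))

    free-reach? : Decidable (Reach G Free ℓ)
    free-reach? = reach? free? ℓ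

    FirstHit : Fin k → Set
    FirstHit i = ∃[ x ] (Good i x × Adj x (y i) × ∃[ a ] (Reach G Free ℓ a × Adj a x))

    -- As long as no neighbour of `y i` has been met, `Good i` excludes the remaining adjacencies,
    -- so the walk so far is `Free`.
    firstHit : ∀ i {u} → Reach G (Good i) ℓ u → Reach G Free ℓ u ⊎ FirstHit i
    firstHit i start = inj₁ start
    firstHit i (step {v = v} r uv good@(v∈L , v-far)) with firstHit i r
    ... | inj₂ h = inj₂ h
    ... | inj₁ r′ with adj? v (y i)
    ...   | yes vy = inj₂ (v , good , vy , _ , r′ , uv)
    ...   | no ¬vy = inj₁ (step r′ uv (v∈L , far))
      where
      far : ∀ j → ¬ Adj v (y j)
      far j with j ≟ i
      ... | yes refl = ¬vy
      ... | no  j≢i  = v-far j j≢i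

    reach-far : ∀ {u} → Reach G Free ℓ u → ∀ i → ¬ Adj u (y i)
    reach-far start              = ℓ-far
    reach-far (step _ _ (_ , f)) = f

    A-far : ∀ i {u} → u ∈ ⟪ free-reach? ⟫ → ¬ Adj u (y i)
    A-far i u∈A = reach-far (∈-⟪⟫⁻ free-reach? u∈A) i

    A⊆L : ∀ {u} → u ∈ ⟪ free-reach? ⟫ → u ∈ L
    A⊆L u∈A = reach-fold {P = _∈ L} ℓ∈L (λ _ _ → proj₁) (∈-⟪⟫⁻ free-reach? u∈A)

    hit : ∀ i → FirstHit i
    hit i with reaches i
    ... | u , r , uy with firstHit i r
    -- The walk ends at a neighbour of `y i`, so it cannot be `Free` throughout.
    ...   | inj₁ r′ = contradiction uy (reach-far r′ i)
    ...   | inj₂ h  = h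

    x : Fin k → Vertex
    x i = proj₁ (hit i)

    x∈L : ∀ i → x i ∈ L
    x∈L i = proj₁ (proj₁ (proj₂ (hit i)))

    x~y : ∀ i → Adj (x i) (y i)
    x~y i = proj₁ (proj₂ (proj₂ (hit i)))

    private-x : ∀ i j → Adj (x i) (y j) → i ≡ j
    private-x i j xy with j ≟ i
    ... | yes j≡i = sym j≡i
    ... | no  j≢i = contradiction xy (proj₂ (proj₁ (proj₂ (hit i))) j j≢i)

-- Few vertices of L suffice to reach all of S

module _ {G : Graph} where
  open Graph G

  ReachVia : Pred Vertex 0ℓ → Vertex → List Vertex → Vertex → Set
  ReachVia M ℓ Y = Reach G (λ v → M v ⊎ v ∈ˡ Y) ℓ

  module _ {S L R : VertexSet} (sep : Separation G S L R)
           {M : Pred Vertex 0ℓ} (M? : Decidable M) (M∩S-empty : ∀ {v} → M v → v ∉ S)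
           {ℓ : Vertex} (ℓ∈L : ℓ ∈ L) {vs : List Vertex} (vs⊆L : All (_∈ L) vs)
           (L⊆M∪N[vs] : ∀ {u} → u ∈ L → M u ⊎ NearAny G vs u) where
    open Separation sep

    reachVia? : ∀ Y → Decidable (ReachVia M ℓ Y)
    reachVia? Y = reach? (λ v → M? v ⊎-dec Any.any? (v ≟_) Y) ℓ

    reachVia-mono : ∀ {Y Y′} → (∀ {y} → y ∈ˡ Y → y ∈ˡ Y′) → ∀ {u} → ReachVia M ℓ Y u → ReachVia M ℓ Y′ u
    reachVia-mono Y⊆Y′ = reach-map (Sum.map₂ Y⊆Y′)

    -- A walk leaves `L` only through `S`, which `M` avoids, and the helpers are taken from `L`.
    reachVia⊆L : ∀ {Y} → All (_∈ L) Y → ∀ {u} → ReachVia M ℓ Y u → u ∈ L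
    reachVia⊆L Y⊆L = reach-fold {P = _∈ L} ℓ∈L λ where
      u∈L uv (inj₁ Mv)  → [ id , (λ v∈S → contradiction v∈S (M∩S-empty Mv)) ] (N[L]⊆S u∈L uv)
      u∈L uv (inj₂ v∈Y) → All.lookup Y⊆L v∈Y

    Hits : List Vertex → Vertex → Set
    Hits Y s = ∃[ u ] (ReachVia M ℓ Y u × Adj u s)

    hits? : ∀ Y → Decidable (Hits Y)
    hits? Y s = any? (λ u → reachVia? Y u ×-dec adj? u s)

    -- The three vertices `v`, `q₂`, `q₁` are the price of attaching one more element of `vs`; this
    -- is the source of the factor 3 below.
    NewlyReached : List Vertex → Set
    NewlyReached Y = ∃[ v ] (v ∈ˡ vs × ¬ ReachVia M ℓ Y v ×
      ∃₂ λ q₁ q₂ → q₁ ∈ L × q₂ ∈ L × ReachVia M ℓ (v ∷ q₂ ∷ q₁ ∷ Y) v)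

    -- Along a walk in L from ℓ, a vertex outside M is near some v in vs: either
    -- v is reached already, and this vertex may replace q, or v is newly reached.
    reach-one-more : ∀ Y {u} → u ∈ L → (∃[ q ] (q ∈ L × ReachVia M ℓ (q ∷ Y) u)) ⊎ NewlyReached Y
    reach-one-more Y u∈L = connected-fold {G = G} {P = P} extend (inj₁ (ℓ , ℓ∈L , start)) (proj₂ L-connected ℓ∈L u∈L)
      where
      P : Pred Vertex 0ℓ
      P u = (∃[ q ] (q ∈ L × ReachVia M ℓ (q ∷ Y) u)) ⊎ NewlyReached Y

      extend : ∀ {u u′} → P u → Adj u u′ → u ∈ L → u′ ∈ L → P u′
      extend (inj₂ new) _ _ _ = inj₂ new
      extend {u} {u′} (inj₁ (q , q∈L , r)) uu′ _ u′∈L with L⊆M∪N[vs] u′∈L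
      ... | inj₁ Mu′ = inj₁ (q , q∈L , step r uu′ (inj₁ Mu′))
      ... | inj₂ near = let (v , v∈vs , u′~v) = find near in near-case v∈vs u′~v (reachVia? Y v)
        where
        near-case : ∀ {v} → v ∈ˡ vs → Near G u′ v → Dec (ReachVia M ℓ Y v) → P u′
        near-case _ (inj₁ refl) (yes r′) = inj₁ (q , q∈L , reachVia-mono there r′)
        near-case _ (inj₂ u′v)  (yes r′) =
          inj₁ (u′ , u′∈L , step (reachVia-mono there r′) (symm u′v) (inj₂ (here refl)))
        near-case {v} v∈vs u′~v (no ¬r) = inj₂ (v , v∈vs , ¬r , q , u′ , q∈L , u′∈L , to-v u′~v)
          where
          to-u′ : ReachVia M ℓ (v ∷ u′ ∷ q ∷ Y) u′
          to-u′ = step (reachVia-mono (there ∘ there) r) uu′ (inj₂ (there (here refl)))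

          to-v : Near G u′ v → ReachVia M ℓ (v ∷ u′ ∷ q ∷ Y) v
          to-v (inj₁ refl) = to-u′
          to-v (inj₂ u′v)  = step to-u′ u′v (inj₂ (here refl))

    newlyReached : ∀ {Y v} → v ∈ˡ vs → ¬ ReachVia M ℓ Y v → NewlyReached Y
    newlyReached {Y} {v} v∈vs ¬r with reach-one-more Y (All.lookup vs⊆L v∈vs)
    ... | inj₂ new = new
    -- A single helper suffices here; `q` is repeated to fill the second place.
    ... | inj₁ (q , q∈L , r) = v , v∈vs , ¬r , q , q , q∈L , q∈L , reachVia-mono (there ∘ there) r

    -- `C` retains every element of `vs` that is not yet reached. Each round removes one element
    -- from `C` and adds three vertices to `Y`.
    reach-all : ∀ m C → ∣ C ∣ ≤ m → ∀ {Y} → All (_∈ L) Y →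
      (∀ {v} → v ∈ˡ vs → v ∈ C ⊎ ReachVia M ℓ Y v) →
      ∃[ Y′ ] (All (_∈ L) Y′ × length Y′ ≤ m * 3 + length Y × All (ReachVia M ℓ Y′) vs)
    reach-all m C ∣C∣≤m {Y} Y⊆L C-or-reached with All.all? (reachVia? Y) vs
    ... | yes reached = Y , Y⊆L , m≤n+m _ (m * 3) , reached
    ... | no ¬reached with find (¬All⇒Any¬ (reachVia? Y) vs ¬reached)
    ...   | v₀ , v₀∈vs , ¬r₀ with newlyReached v₀∈vs ¬r₀
    ...     | v , v∈vs , ¬r , q₁ , q₂ , q₁∈L , q₂∈L , r with C-or-reached v∈vs
    ...       | inj₂ r′ = contradiction r′ ¬r
    ...       | inj₁ v∈C with m | ≤-trans (x∈p⇒∣p-x∣<∣p∣ v∈C) ∣C∣≤m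
    ...         | suc m | s≤s ∣C-v∣≤m
      with reach-all m (C - v) ∣C-v∣≤m (All.lookup vs⊆L v∈vs ∷ q₂∈L ∷ q₁∈L ∷ Y⊆L) C-or-reached′
      where
      C-or-reached′ : ∀ {w} → w ∈ˡ vs → w ∈ C - v ⊎ ReachVia M ℓ (v ∷ q₂ ∷ q₁ ∷ Y) w
      C-or-reached′ {w} w∈vs with C-or-reached w∈vs | w ≟ v
      ... | _        | yes refl = inj₂ r
      ... | inj₁ w∈C | no w≢v   = inj₁ (x∈p∧x≢y⇒x∈p-y w∈C w≢v)
      ... | inj₂ r′  | no _     = inj₂ (reachVia-mono (there ∘ there ∘ there) r′)
    ... | Y′ , Y′⊆L , ∣Y′∣≤ , reached = Y′ , Y′⊆L , ≤-trans ∣Y′∣≤ (≤-reflexive (eq m (length Y))) , reached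
      where
      eq : ∀ m l → m * 3 + (3 + l) ≡ suc m * 3 + l
      eq = solve 2 (λ m l → m :* con 3 :+ (con 3 :+ l) := (con 1 :+ m) :* con 3 :+ l) refl
        where open +-*-Solver

    module _ {Y : List Vertex} (Y⊆L : All (_∈ L) Y) (vs-reached : All (ReachVia M ℓ Y) vs) where

      -- With all of `vs` reached nothing can be newly reached, so one helper gives access to any
      -- vertex of `L`, in particular to a neighbour of `s`.
      hits-one-more : ∀ {s} → s ∈ S → ∃[ w ] (w ∈ L × Hits (w ∷ Y) s)
      hits-one-more s∈S with S⊆N[L] s∈S
      ... | u , u∈L , su with reach-one-more Y u∈L
      ...   | inj₁ (q , q∈L , r)        = q , q∈L , u , r , symm su
      ...   | inj₂ (v , v∈vs , ¬r , _) = contradiction (All.lookup vs-reached v∈vs) ¬r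

      -- Each `s` is hit with one helper at a time, not with all of `W` at once; this lets distinct
      -- helpers have private neighbours.
      Covers : Pred VertexSet 0ℓ
      Covers W = ∀ s → s ∈ S → ∃[ w ] (w ∈ W × Hits (w ∷ Y) s)

      coverAt? : ∀ W s → Dec (s ∈ S → ∃[ w ] (w ∈ W × Hits (w ∷ Y) s))
      coverAt? W s = s ∈? S →-dec any? (λ w → w ∈? W ×-dec hits? (w ∷ Y) s)

      covers? : Decidable Covers
      covers? W = all? (coverAt? W)

      module _ {W : VertexSet} (W⊆L : W ⊆ L) (covers : Covers W)
               (minimal : ∀ {w} → w ∈ W → ¬ Covers (W - w)) where

        -- Deleting `w` breaks the cover at some `s`; as `W` covers `s`, only `w` can be
        -- responsible.
        private-neighbour : ∀ {w} → w ∈ W →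
          ∃[ s ] (s ∈ S × Hits (w ∷ Y) s × (∀ {w′} → w′ ∈ W → w′ ≢ w → ¬ Hits (w′ ∷ Y) s))
        private-neighbour {w} w∈W with ¬∀⟶∃¬ order _ (coverAt? (W - w)) (minimal w∈W)
        ... | s , ¬covered with s ∈? S
        ...   | no  s∉S = contradiction (λ s∈S → contradiction s∈S s∉S) ¬covered
        ...   | yes s∈S = s , s∈S , hit , others
          where
          others : ∀ {w′} → w′ ∈ W → w′ ≢ w → ¬ Hits (w′ ∷ Y) s
          others w′∈W w′≢w h = ¬covered (λ _ → _ , x∈p∧x≢y⇒x∈p-y w′∈W w′≢w , h)

          hit : Hits (w ∷ Y) s
          hit with covers s s∈S
          ... | w′ , w′∈W , h with w′ ≟ w
          ...   | yes refl = h
          ...   | no w′≢w  = contradiction h (others w′∈W w′≢w)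

        -- The private neighbour of w zero is given up, to make sure that ℓ is
        -- not adjacent to the others.
        large-cover⇒creature : ∀ {k} → k < ∣ W ∣ → Creature G k
        large-cover⇒creature {k} k<∣W∣ = separation⇒creature sep ℓ∈L (s ∘ suc) s-injective
          (s∈S ∘ suc)
          -- The start `ℓ` is reached with any helper, in particular with `w zero`.
          (λ i ℓs → s-private zero (suc i) (λ ()) (ℓ , start , ℓs))
          -- All vertices of the walk are reached with `w (suc i)`, so adjacency to another
          -- `s (suc j)` would violate its privacy.
          (λ i → let (u , r , us) = s-hit (suc i)
                 in u , reach-refine (λ r′ → reachVia⊆L (W⊆L (w∈W (suc i)) ∷ Y⊆L) r′
                                           , λ j j≢i vs → s-private (suc i) (suc j) (j≢i ∘ sym ∘ suc-injective) (_ , r′ , vs)) r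
                    , us)
          where
          w : Fin (suc k) → Vertex
          w i = enum W (inject≤ i k<∣W∣)

          w-injective : ∀ {i j} → w i ≡ w j → i ≡ j
          w-injective eq = inject≤-injective k<∣W∣ k<∣W∣ _ _ (enum-injective W eq)

          w∈W : ∀ i → w i ∈ W
          w∈W i = enum-∈ W (inject≤ i k<∣W∣)

          s : Fin (suc k) → Vertex
          s i = proj₁ (private-neighbour (w∈W i))

          s∈S : ∀ i → s i ∈ S
          s∈S i = proj₁ (proj₂ (private-neighbour (w∈W i)))

          s-hit : ∀ i → Hits (w i ∷ Y) (s i)
          s-hit i = proj₁ (proj₂ (proj₂ (private-neighbour (w∈W i))))

          s-private : ∀ i j → i ≢ j → ¬ Hits (w i ∷ Y) (s j)
          s-private i j i≢j = proj₂ (proj₂ (proj₂ (private-neighbour (w∈W j)))) (w∈W i) (i≢j ∘ w-injective)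

          s-injective : Injective _≡_ _≡_ (s ∘ suc)
          s-injective {i} {j} eq with i ≟ j
          ... | yes i≡j = i≡j
          ... | no  i≢j = contradiction (subst (Hits (w (suc i) ∷ Y)) eq (s-hit (suc i)))
                                        (s-private (suc i) (suc j) (i≢j ∘ suc-injective))

    -- At most `k` vertices come from a minimal cover, since a larger one yields a creature, and
    -- three for each element of `vs` from `reach-all`.
    few-vertices-reach-S : ∀ {k} → CreatureFree G k →
      ∃[ Y ] (All (_∈ L) Y × length Y ≤ k + length vs * 3 × (∀ {s} → s ∈ S → Hits Y s))
    few-vertices-reach-S {k} free
      with reach-all (length vs) (fromList vs) (∣fromList∣≤length vs) [] (inj₁ ∘ ∈-fromList⁺)
    ... | Y , Y⊆L , ∣Y∣≤ , reached
      -- The whole of `L` is a cover, from which a minimal one is extracted.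
      with minimal-subset (covers? Y⊆L reached) L (λ s s∈S → hits-one-more Y⊆L reached s∈S)
    ... | W , W⊆L , covers , minimal with ∣ W ∣ ≤? k
    ...   | no ∣W∣≰k = contradiction (large-cover⇒creature Y⊆L reached W⊆L covers minimal (≰⇒> ∣W∣≰k)) free
    ...   | yes ∣W∣≤k =
      elems W ++ Y ,
      All-++⁺ (All.tabulate (W⊆L ∘ ∈-elems⁻)) Y⊆L ,
      subst (_≤ k + length vs * 3) (sym (length-++ (elems W)))
        (+-mono-≤ (subst (_≤ k) (sym (length-elems W)) ∣W∣≤k)
                  (subst (length Y ≤_) (+-identityʳ _) ∣Y∣≤)) ,
      λ s∈S → let (w , w∈W , u , r , us) = covers _ s∈S
              in u , reachVia-mono (λ { (here refl) → ∈-++⁺ˡ (∈-elems⁺ w∈W)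
                                      ; (there y∈)  → ∈-++⁺ʳ (elems W) y∈ }) r , us

-- Induced subgraphs

module _ (G : Graph) (X : Subset (Graph.order G)) where
  open Graph G

  induced : Graph
  induced = record
    { order  = ∣ X ∣
    ; Adj    = λ i j → Adj (enum X i) (enum X j)
    ; adj?   = λ i j → adj? (enum X i) (enum X j)
    ; symm   = symm
    ; irrefl = λ { refl → irrefl refl }
    }

  induced-InducedIn : induced InducedIn G
  induced-InducedIn = record
    { embed     = enum X
    ; injective = enum-injective X
    ; adj⇔adj   = λ _ _ → mk⇔ id id
    }

  trace : VertexSet → Subset ∣ X ∣
  trace Y = ⟪ (λ i → enum X i ∈? Y) ⟫

  ∈-trace⁺ : ∀ {Y i} → enum X i ∈ Y → i ∈ trace Y
  ∈-trace⁺ {Y} = ∈-⟪⟫⁺ (λ i → enum X i ∈? Y)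

  ∈-trace⁻ : ∀ {Y i} → i ∈ trace Y → enum X i ∈ Y
  ∈-trace⁻ {Y} = ∈-⟪⟫⁻ (λ i → enum X i ∈? Y)

  connected-trace : ∀ {C} → C ⊆ X → Connected G C → Connected induced (trace C)
  connected-trace {C} C⊆X ((c , c∈C) , walks) with enum-surjective X (C⊆X c∈C)
  ... | i₀ , refl = (i₀ , ∈-trace⁺ c∈C) , λ i∈ j∈ → lift (walks (∈-trace⁻ i∈) (∈-trace⁻ j∈)) refl refl
    where
    lift : ∀ {u v} → Star (AdjWithin G C) u v →
           ∀ {i j} → enum X i ≡ u → enum X j ≡ v → Star (AdjWithin induced (trace C)) i j
    lift ε refl j≡ with enum-injective X j≡
    ... | refl = ε
    lift ((u∈C , v∈C , uv) ◅ w) refl j≡ with enum-surjective X (C⊆X v∈C)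
    ... | _ , refl = (∈-trace⁺ u∈C , ∈-trace⁺ v∈C , uv) ◅ lift w refl j≡

  -- Since `X` keeps `L` and `R` entire, both remain connected and every surviving vertex of `S`
  -- keeps its neighbours in them.
  separation-trace : ∀ {S L R} → L ⊆ X → R ⊆ X → Separation G S L R →
                     Separation induced (trace S) (trace L) (trace R)
  separation-trace {S} L⊆X R⊆X sep = record
    { L-connected = connected-trace L⊆X L-connected
    ; R-connected = connected-trace R⊆X R-connected
    ; L∩R-empty   = λ i∈L i∈R → L∩R-empty (∈-trace⁻ i∈L) (∈-trace⁻ i∈R)
    ; L∩S-empty   = λ i∈L i∈S → L∩S-empty (∈-trace⁻ i∈L) (∈-trace⁻ i∈S)
    ; R∩S-empty   = λ i∈R i∈S → R∩S-empty (∈-trace⁻ i∈R) (∈-trace⁻ i∈S)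
    ; N[L]⊆S      = λ i∈L ij → Sum.map ∈-trace⁺ ∈-trace⁺ (N[L]⊆S (∈-trace⁻ i∈L) ij)
    ; N[R]⊆S      = λ i∈R ij → Sum.map ∈-trace⁺ ∈-trace⁺ (N[R]⊆S (∈-trace⁻ i∈R) ij)
    ; S⊆N[L]      = λ i∈S → neighbour L⊆X (S⊆N[L] (∈-trace⁻ i∈S))
    ; S⊆N[R]      = λ i∈S → neighbour R⊆X (S⊆N[R] (∈-trace⁻ i∈S))
    }
    where
    open Separation sep

    neighbour : ∀ {C i} → C ⊆ X → HasNeighborIn G C (enum X i) → HasNeighborIn induced (trace C) i
    neighbour C⊆X (u , u∈C , su) with enum-surjective X (C⊆X u∈C)
    ... | j , refl = j , ∈-trace⁺ u∈C , su

-- Domination of the separator after deletion of `H`, expressed in `G`. A vertex of `S` outside `H`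
-- must exist because minimal separators are non-empty.
DominatedOutside : Graph → ℕ → Set
DominatedOutside G k′ = let open Graph G in
  ∀ {S L R} H → Separation G S L R → (∀ {u} → u ∈ H → u ∉ L) → (∀ {u} → u ∈ H → u ∉ R) →
  (∃[ s ] (s ∈ S × s ∉ H)) →
  ∃[ D ] (length D ≤ k′ × All (_∉ H) D × (∀ {s} → s ∈ S → s ∉ H → NearAny G D s))

-- Deleting `H` stays in the class, and the trace of `S` is a minimal separator there; its
-- dominating set is carried back to `G` by `enum`.
hereditary⇒dominatedOutside : ∀ {ℓ} {F : GraphClass ℓ} {k′} → Hereditary F →
  (∀ G → F G → SeparatorsDominatedBy G k′) → ∀ {G} → F G → DominatedOutside G k′
hereditary⇒dominatedOutside {k′ = k′} hereditary dominated {G} G∈F {S} {L} {R} H sep H∩L H∩R (s₀ , s₀∈S , s₀∉H)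
  with enum-surjective (∁ H) (x∉p⇒x∈∁p s₀∉H)
... | i₀ , refl
  with dominated (induced G (∁ H)) (hereditary G∈F (induced-InducedIn G (∁ H)))
         (separation⇒minimalSeparator {G = induced G (∁ H)} (i₀ , ∈-trace⁺ G (∁ H) s₀∈S)
           (separation-trace G (∁ H) (λ u∈L → x∉p⇒x∈∁p (λ u∈H → H∩L u∈H u∈L))
                                     (λ u∈R → x∉p⇒x∈∁p (λ u∈H → H∩R u∈H u∈R)) sep))
... | D , ∣D∣≤k′ , dominates =
  map (enum (∁ H)) (elems D) ,
  subst (_≤ k′) (sym (trans (length-map (enum (∁ H)) (elems D)) (length-elems D))) ∣D∣≤k′ ,
  All.tabulate (λ d∈ → let (i , _ , eq) = ∈-map⁻ (enum (∁ H)) d∈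
                       in x∈∁p⇒x∉p (subst (_∈ ∁ H) (sym eq) (enum-∈ (∁ H) i))) ,
  near
  where
  open Graph G

  near : ∀ {s} → s ∈ S → s ∉ H → NearAny G (map (enum (∁ H)) (elems D)) s
  near s∈S s∉H with enum-surjective (∁ H) (x∉p⇒x∈∁p s∉H)
  ... | i , refl with dominates (∈-trace⁺ G (∁ H) s∈S)
  ...   | inj₁ i∈D           = lose (∈-map⁺ (enum (∁ H)) (∈-elems⁺ i∈D)) (inj₁ refl)
  ...   | inj₂ (j , j∈D , ij) = lose (∈-map⁺ (enum (∁ H)) (∈-elems⁺ j∈D)) (inj₂ ij)

-- Locating separators

module _ (G : Graph) where
  open Graph G

  record Fits (Z : VertexSet) (vs ws : List Vertex) (U S : VertexSet) : Set where
    field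
      {L R}     : VertexSet
      sep       : Separation G S L R
      vs⊆L      : All (_∈ L) vs
      ws⊆R      : All (_∈ R) ws
      Z∩L-empty : ∀ {u} → u ∈ Z → u ∉ L
      Z∩R-empty : ∀ {u} → u ∈ Z → u ∉ R
      located   : ∀ {s} → s ∈ S → s ∈ Z ⊎ NearAny G vs s ⊎ NearAny G ws s ⊎ s ∈ U

    open Separation sep public

    N[vs]∩R-empty : ∀ {u} → NearAny G vs u → u ∉ R
    N[vs]∩R-empty near u∈R with find near
    ... | v , v∈vs , inj₁ refl = L∩R-empty (All.lookup vs⊆L v∈vs) u∈R
    ... | v , v∈vs , inj₂ uv   = L-anticomplete-R (All.lookup vs⊆L v∈vs) u∈R (symm uv)

    N[ws]∩L-empty : ∀ {u} → NearAny G ws u → u ∉ L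
    N[ws]∩L-empty near u∈L with find near
    ... | w , w∈ws , inj₁ refl = L∩R-empty u∈L (All.lookup ws⊆R w∈ws)
    ... | w , w∈ws , inj₂ uw   = L-anticomplete-R u∈L (All.lookup ws⊆R w∈ws) uw

  module _ {Z : VertexSet} {vs ws : List Vertex} {U : VertexSet} (U-empty : ∀ {u} → u ∉ U)
           {ℓ r : Vertex} (ℓ∈vs : ℓ ∈ˡ vs) (r∈ws : r ∈ˡ ws) where

    Unlocated : Pred Vertex 0ℓ
    Unlocated v = v ∉ Z × ¬ NearAny G vs v × ¬ NearAny G ws v

    unlocated? : Decidable Unlocated
    unlocated? v = ¬? (v ∈? Z) ×-dec ¬? (nearAny? G vs v) ×-dec ¬? (nearAny? G ws v)

    unlocated∉S : ∀ {S v} → Fits Z vs ws U S → Unlocated v → v ∉ S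
    unlocated∉S fits (v∉Z , v≁vs , v≁ws) v∈S with Fits.located fits v∈S
    ... | inj₁ v∈Z                = v∉Z v∈Z
    ... | inj₂ (inj₁ near)        = v≁vs near
    ... | inj₂ (inj₂ (inj₁ near)) = v≁ws near
    ... | inj₂ (inj₂ (inj₂ v∈U))  = U-empty v∈U

    Reached : List Vertex → VertexSet → Set
    Reached Y S = Σ[ fits ∈ Fits Z vs ws U S ] (All (_∈ Fits.L fits) Y ×
      (∀ {s} → s ∈ S → ∃[ u ] (ReachVia {G = G} Unlocated ℓ Y u × Adj u s)))

    -- S ∩ N[ws] consists of the vertices of N[ws] that have a neighbour reached from ℓ.
    reached-∩N[ws]-⊆ : ∀ {Y S S′} → Reached Y S → Reached Y S′ → ∀ {v} → NearAny G ws v → v ∈ S → v ∈ S′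
    reached-∩N[ws]-⊆ {S′ = S′} (_ , _ , hits) (fits′ , Y⊆L′ , _) near v∈S with hits v∈S
    ... | u , ru , uv
      -- The walk to `u` is read with respect to `S′`: it starts in `L′` and never meets `S′`, so
      -- `u` is in `L′` and `v` in `L′` or `S′`.
      with N[L]⊆S (reach-fold {P = _∈ L} (All.lookup vs⊆L ℓ∈vs) (λ where
             a∈L ab (inj₁ b-unlocated)  → [ id , (λ b∈S′ → contradiction b∈S′ (unlocated∉S fits′ b-unlocated)) ] (N[L]⊆S a∈L ab)
             a∈L ab (inj₂ b∈Y) → All.lookup Y⊆L′ b∈Y) ru) uv
      where open Fits fits′
    ...   | inj₁ v∈L′ = contradiction v∈L′ (Fits.N[ws]∩L-empty fits′ near)
    ...   | inj₂ v∈S′ = v∈S′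

    -- A walk in `R` from `r` never meets `S′`: `Z` and `N[vs]` miss `R`, and in `N[ws]` the
    -- separators `S` and `S′` agree.
    reached-R-⊆ : ∀ {Y S S′} (h : Reached Y S) (h′ : Reached Y S′) → Fits.R (proj₁ h) ⊆ Fits.R (proj₁ h′)
    reached-R-⊆ {S′ = S′} h@(fits , _) h′@(fits′ , _) u∈R = connected-fold {G = G} {P = _∈ R′} extend
      (All.lookup (Fits.ws⊆R fits′) r∈ws) (proj₂ R-connected (All.lookup ws⊆R r∈ws) u∈R)
      where
      open Fits fits
      R′ = Fits.R fits′

      R∩S′-empty : ∀ {v} → v ∈ R → v ∉ S′
      R∩S′-empty v∈R v∈S′ with Fits.located fits′ v∈S′
      ... | inj₁ v∈Z                = Z∩R-empty v∈Z v∈R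
      ... | inj₂ (inj₁ near)        = N[vs]∩R-empty near v∈R
      ... | inj₂ (inj₂ (inj₁ near)) = R∩S-empty v∈R (reached-∩N[ws]-⊆ h′ h near v∈S′)
      ... | inj₂ (inj₂ (inj₂ v∈U))  = U-empty v∈U

      extend : ∀ {u v} → u ∈ R′ → Adj u v → u ∈ R → v ∈ R → v ∈ R′
      extend u∈R′ uv _ v∈R with Fits.N[R]⊆S fits′ u∈R′ uv
      ... | inj₁ v∈R′ = v∈R′
      ... | inj₂ v∈S′ = contradiction v∈S′ (R∩S′-empty v∈R)

    -- By symmetry `R` is the same for both separators, and each separator is its neighbourhood.
    reached-S-⊆ : ∀ {Y S S′} → Reached Y S → Reached Y S′ → S ⊆ S′
    reached-S-⊆ h@(fits , _) h′@(fits′ , _) s∈S with Fits.S⊆N[R] fits s∈S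
    ... | u , u∈R , su with Fits.N[R]⊆S fits′ (reached-R-⊆ h h′ u∈R) (symm su)
    ...   | inj₁ s∈R′ = contradiction s∈S (Fits.R∩S-empty fits (reached-R-⊆ h′ h s∈R′))
    ...   | inj₂ s∈S′ = s∈S′

    -- `Z` and `N[ws]` miss `L`, so each vertex of `L` is unlocated or near `vs`, as
    -- `few-vertices-reach-S` demands.
    fits⇒reached : ∀ {k} → CreatureFree G k → ∀ {S} → Fits Z vs ws U S →
                   ∃[ Y ] (length Y ≡ k + length vs * 3 × Reached Y S)
    fits⇒reached {k} free {S} fits = pad (few-vertices-reach-S
      sep unlocated? (unlocated∉S fits) (All.lookup vs⊆L ℓ∈vs) vs⊆L L⊆ free)
      where
      open Fits fits

      L⊆ : ∀ {u} → u ∈ L → Unlocated u ⊎ NearAny G vs u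
      L⊆ {u} u∈L with nearAny? G vs u
      ... | yes near = inj₂ near
      ... | no ¬near = inj₁ ((λ u∈Z → Z∩L-empty u∈Z u∈L) , ¬near , λ near → N[ws]∩L-empty near u∈L)

      pad : ∃[ Y ] (All (_∈ L) Y × length Y ≤ k + length vs * 3 ×
              (∀ {s} → s ∈ S → ∃[ u ] (ReachVia {G = G} Unlocated ℓ Y u × Adj u s))) →
            ∃[ Y ] (length Y ≡ k + length vs * 3 × Reached Y S)
      pad (Y , Y⊆L , ∣Y∣≤ , hits) =
        padTo _ ℓ Y , length-padTo {xs = Y} ∣Y∣≤ , fits , all-padTo (All.lookup vs⊆L ℓ∈vs) Y⊆L ,
        λ s∈S → let (u , ru , us) = hits s∈S
                in u , reach-map (Sum.map₂ (∈-padTo⁺ {xs = Y})) ru , us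

    -- `Y` determines `S`, so there are no more separators than lists `Y`.
    fits-atMost : ∀ {k} → CreatureFree G k → AtMost (order ^ (k + length vs * 3)) (Fits Z vs ws U)
    fits-atMost {k} free = atMost-map (fits⇒reached free)
      (atMost-mono (≤-reflexive (*-identityʳ _))
        (atMost-∃-list (k + length vs * 3) {P = Reached}
          (λ Y → atMost-subsingleton (λ h h′ → ⊆-antisym (reached-S-⊆ h h′) (reached-S-⊆ h′ h)))))

-- Rounds of guesses

  N[_] : Vertex → VertexSet
  N[ v ] = ⟪ (λ u → near? G u v) ⟫

  module _ {k k′ : ℕ} (free : CreatureFree G k) (dominated : DominatedOutside G k′) (2≤n : 2 ≤ order) where

    private
      n = order
      K = suc k′

      instance
        n-nonZero : NonZero n
        n-nonZero = >-nonZero (≤-trans (s≤s z≤n) 2≤n)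

    -- The threshold is `2 ^ j / K` with the denominator cleared. It refers to `2 ^ j` instead of
    -- `∣ U ∣`, hence stays fixed during one halving.
    Heavy : ℕ → VertexSet → Vertex → Set
    Heavy j U v = 2 ^ j ≤ K * ∣ U ∩ N[ v ] ∣

    heavy? : ∀ j U → Decidable (Heavy j U)
    heavy? j U v = 2 ^ j ≤? K * ∣ U ∩ N[ v ] ∣

    heavySet : ℕ → VertexSet → VertexSet
    heavySet j U = ⟪ heavy? j U ⟫

    -- Heavy entries of `D` are ignored, so the vertices added by padding do no harm.
    LightNear : ℕ → VertexSet → List Vertex → Pred Vertex 0ℓ
    LightNear j U D u = Any (λ d → ¬ Heavy j U d × Near G u d) D

    lightNear? : ∀ j U D → Decidable (LightNear j U D)
    lightNear? j U D u = Any.any? (λ d → ¬? (heavy? j U d) ×-dec near? G u d) D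

    lightPart : ℕ → VertexSet → List Vertex → VertexSet
    lightPart j U D = U ∩ ⟪ lightNear? j U D ⟫

    -- A light entry accounts for less than `2 ^ j / K` vertices of `U`, a heavy one for none.
    K∣lightPart∣≤ : ∀ j U D → K * ∣ lightPart j U D ∣ ≤ length D * 2 ^ j
    K∣lightPart∣≤ j U [] = ≤-reflexive (trans (cong (K *_) ∣lightPart∣≡0) (*-zeroʳ K))
      where
      ∣lightPart∣≡0 : ∣ lightPart j U [] ∣ ≡ 0
      ∣lightPart∣≡0 = n≤0⇒n≡0 (subst (∣ lightPart j U [] ∣ ≤_) (∣⊥∣≡0 n)
        (p⊆q⇒∣p∣≤∣q∣ λ u∈ → case∅ (∈-⟪⟫⁻ (lightNear? j U []) (proj₂ (x∈p∩q⁻ U _ u∈)))))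
        where
        case∅ : ∀ {u} → LightNear j U [] u → u ∈ ⊥
        case∅ ()
    K∣lightPart∣≤ j U (d ∷ D) with heavy? j U d
    ... | yes heavy = ≤-trans (*-monoʳ-≤ K (p⊆q⇒∣p∣≤∣q∣ drop-d))
                        (≤-trans (K∣lightPart∣≤ j U D) (m≤n+m _ (2 ^ j)))
      where
      drop-d : lightPart j U (d ∷ D) ⊆ lightPart j U D
      drop-d u∈ with x∈p∩q⁻ U _ u∈
      ... | u∈U , u∈′ with ∈-⟪⟫⁻ (lightNear? j U (d ∷ D)) u∈′
      ...   | here (light , _) = contradiction heavy light
      ...   | there near       = x∈p∩q⁺ (u∈U , ∈-⟪⟫⁺ (lightNear? j U D) near)
    ... | no light = begin
      K * ∣ lightPart j U (d ∷ D) ∣                     ≤⟨ *-monoʳ-≤ K (p⊆q⇒∣p∣≤∣q∣ split-d) ⟩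
      K * ∣ (U ∩ N[ d ]) ∪ lightPart j U D ∣            ≤⟨ *-monoʳ-≤ K (∣p∪q∣≤∣p∣+∣q∣ (U ∩ N[ d ]) _) ⟩
      K * (∣ U ∩ N[ d ] ∣ + ∣ lightPart j U D ∣)        ≡⟨ *-distribˡ-+ K ∣ U ∩ N[ d ] ∣ _ ⟩
      K * ∣ U ∩ N[ d ] ∣ + K * ∣ lightPart j U D ∣      ≤⟨ +-mono-≤ (<⇒≤ (≰⇒> light)) (K∣lightPart∣≤ j U D) ⟩
      2 ^ j + length D * 2 ^ j                          ∎
      where
      open ≤-Reasoning

      split-d : lightPart j U (d ∷ D) ⊆ (U ∩ N[ d ]) ∪ lightPart j U D
      split-d u∈ with x∈p∩q⁻ U _ u∈
      ... | u∈U , u∈′ with ∈-⟪⟫⁻ (lightNear? j U (d ∷ D)) u∈′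
      ...   | here (_ , near) = x∈p∪q⁺ (inj₁ (x∈p∩q⁺ (u∈U , ∈-⟪⟫⁺ (λ u → near? G u d) near)))
      ...   | there near      = x∈p∪q⁺ (inj₂ (x∈p∩q⁺ (u∈U , ∈-⟪⟫⁺ (lightNear? j U D) near)))

    ∈-─-N : ∀ {U v u} → u ∈ U → Near G u v ⊎ u ∈ U ─ N[ v ]
    ∈-─-N {U} {v} {u} u∈U with near? G u v
    ... | yes near = inj₁ near
    ... | no ¬near = inj₂ (x∈p∧x∉q⇒x∈p─q u∈U (¬near ∘ ∈-⟪⟫⁻ (λ u → near? G u v)))

    -- A heavy vertex of L or R is guessed. If there is none, the heavy vertices
    -- lie outside L ∪ R, and they are deleted before the domination is applied.
    Guess : ℕ → (Z : VertexSet) (vs ws : List Vertex) (U S : VertexSet) → Set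
    Guess j Z vs ws U S =
      (∃[ v ] (Heavy j U v × Fits Z (v ∷ vs) ws (U ─ N[ v ]) S)) ⊎
      (∃[ v ] (Heavy j U v × Fits Z vs (v ∷ ws) (U ─ N[ v ]) S)) ⊎
      (∃[ D ] (length D ≡ k′ × Fits (Z ∪ heavySet j U) vs ws (lightPart j U D) S))

    guess : ∀ j {Z vs ws U} → Vertex → ∀ {S} → Fits Z vs ws U S → Guess j Z vs ws U S
    guess j {Z} {vs} {ws} {U} v₀ {S} fits
      with any? (λ v → heavy? j U v ×-dec v ∈? Fits.L fits) | any? (λ v → heavy? j U v ×-dec v ∈? Fits.R fits)
    ... | yes (v , heavy , v∈L) | _ = inj₁ (v , heavy , record
      { sep = sep ; vs⊆L = v∈L ∷ vs⊆L ; ws⊆R = ws⊆R ; Z∩L-empty = Z∩L-empty ; Z∩R-empty = Z∩R-empty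
      ; located = relocate ∘ located })
      where
      open Fits fits
      relocate : ∀ {s} → s ∈ Z ⊎ NearAny G vs s ⊎ NearAny G ws s ⊎ s ∈ U →
                 s ∈ Z ⊎ NearAny G (v ∷ vs) s ⊎ NearAny G ws s ⊎ s ∈ U ─ N[ v ]
      relocate (inj₁ s∈Z)                = inj₁ s∈Z
      relocate (inj₂ (inj₁ near))        = inj₂ (inj₁ (there near))
      relocate (inj₂ (inj₂ (inj₁ near))) = inj₂ (inj₂ (inj₁ near))
      relocate (inj₂ (inj₂ (inj₂ s∈U))) with ∈-─-N s∈U
      ... | inj₁ near = inj₂ (inj₁ (here near))
      ... | inj₂ s∈U′ = inj₂ (inj₂ (inj₂ s∈U′))
    ... | no _ | yes (v , heavy , v∈R) = inj₂ (inj₁ (v , heavy , record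
      { sep = sep ; vs⊆L = vs⊆L ; ws⊆R = v∈R ∷ ws⊆R ; Z∩L-empty = Z∩L-empty ; Z∩R-empty = Z∩R-empty
      ; located = relocate ∘ located }))
      where
      open Fits fits
      relocate : ∀ {s} → s ∈ Z ⊎ NearAny G vs s ⊎ NearAny G ws s ⊎ s ∈ U →
                 s ∈ Z ⊎ NearAny G vs s ⊎ NearAny G (v ∷ ws) s ⊎ s ∈ U ─ N[ v ]
      relocate (inj₁ s∈Z)                = inj₁ s∈Z
      relocate (inj₂ (inj₁ near))        = inj₂ (inj₁ near)
      relocate (inj₂ (inj₂ (inj₁ near))) = inj₂ (inj₂ (inj₁ (there near)))
      relocate (inj₂ (inj₂ (inj₂ s∈U))) with ∈-─-N s∈U
      ... | inj₁ near = inj₂ (inj₂ (inj₁ (here near)))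
      ... | inj₂ s∈U′ = inj₂ (inj₂ (inj₂ s∈U′))
    ... | no ¬heavyL | no ¬heavyR = inj₂ (inj₂ (light-case (any? λ s → s ∈? S ×-dec ¬? (s ∈? H))))
      where
      open Fits fits
      H = heavySet j U

      H∩L-empty : ∀ {u} → u ∈ H → u ∉ L
      H∩L-empty u∈H u∈L = ¬heavyL (_ , ∈-⟪⟫⁻ (heavy? j U) u∈H , u∈L)

      H∩R-empty : ∀ {u} → u ∈ H → u ∉ R
      H∩R-empty u∈H u∈R = ¬heavyR (_ , ∈-⟪⟫⁻ (heavy? j U) u∈H , u∈R)

      fits-light : ∀ D → (∀ {s} → s ∈ S → s ∉ H → LightNear j U D s) →
                   Fits (Z ∪ H) vs ws (lightPart j U D) S
      fits-light D near = record
        { sep = sep ; vs⊆L = vs⊆L ; ws⊆R = ws⊆R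
        ; Z∩L-empty = λ u∈ → [ Z∩L-empty , H∩L-empty ] (x∈p∪q⁻ Z H u∈)
        ; Z∩R-empty = λ u∈ → [ Z∩R-empty , H∩R-empty ] (x∈p∪q⁻ Z H u∈)
        ; located   = λ s∈S → relocate s∈S (located s∈S)
        }
        where
        relocate : ∀ {s} → s ∈ S → s ∈ Z ⊎ NearAny G vs s ⊎ NearAny G ws s ⊎ s ∈ U →
                   s ∈ Z ∪ H ⊎ NearAny G vs s ⊎ NearAny G ws s ⊎ s ∈ lightPart j U D
        relocate _ (inj₁ s∈Z)                = inj₁ (x∈p∪q⁺ (inj₁ s∈Z))
        relocate _ (inj₂ (inj₁ near))        = inj₂ (inj₁ near)
        relocate _ (inj₂ (inj₂ (inj₁ near))) = inj₂ (inj₂ (inj₁ near))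
        relocate {s} s∈S (inj₂ (inj₂ (inj₂ s∈U))) with s ∈? H
        ... | yes s∈H = inj₁ (x∈p∪q⁺ (inj₂ s∈H))
        ... | no  s∉H = inj₂ (inj₂ (inj₂ (x∈p∩q⁺ (s∈U , ∈-⟪⟫⁺ (lightNear? j U D) (near s∈S s∉H)))))

      light-case : Dec (∃[ s ] (s ∈ S × s ∉ H)) →
                   ∃[ D ] (length D ≡ k′ × Fits (Z ∪ H) vs ws (lightPart j U D) S)
      -- Deleting the heavy vertices would leave no separator to dominate; any `D` of the right
      -- length serves.
      light-case (no S⊆H) = replicate k′ v₀ , length-replicate k′ ,
        fits-light (replicate k′ v₀) (λ s∈S s∉H → contradiction (_ , s∈S , s∉H) S⊆H)
      light-case (yes ∃s) with dominated H sep H∩L-empty H∩R-empty ∃s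
      ... | D , ∣D∣≤k′ , D∩H-empty , near =
        padTo k′ v₀ D , length-padTo {xs = D} ∣D∣≤k′ , fits-light (padTo k′ v₀ D) near-light
        where
        near-light : ∀ {s} → s ∈ S → s ∉ H → LightNear j U (padTo k′ v₀ D) s
        near-light s∈S s∉H with find (near s∈S s∉H)
        -- The dominating vertices survive the deletion of `H`, so they are light.
        ... | d , d∈D , s~d = lose (∈-padTo⁺ {xs = D} d∈D)
          (All.lookup D∩H-empty d∈D ∘ ∈-⟪⟫⁺ (heavy? j U) , s~d)

    -- The exponent for `t` remaining rounds when `vs` has length `m`: `k′ + 3` per round, then the
    -- final list `Y`, for which `vs` has grown to length at most `t + m`.
    cost : ℕ → ℕ → ℕ
    cost t m = t * (k′ + 3) + (k + (t + m) * 3)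

    cost-mono : ∀ {t t′ m m′} → t ≤ t′ → m ≤ m′ → cost t m ≤ cost t′ m′
    cost-mono t≤ m≤ = +-mono-≤ (*-monoˡ-≤ (k′ + 3) t≤) (+-monoʳ-≤ k (*-monoˡ-≤ 3 (+-mono-≤ t≤ m≤)))

    cost-suc : ∀ t m → k′ + 3 + cost t (suc m) ≡ cost (suc t) m
    cost-suc t m = solve 4 (λ k′ k t m →
      k′ :+ con 3 :+ (t :* (k′ :+ con 3) :+ (k :+ (t :+ (con 1 :+ m)) :* con 3)) :=
      (con 1 :+ t) :* (k′ :+ con 3) :+ (k :+ ((con 1 :+ t) :+ m) :* con 3)) refl k′ k t m
      where open +-*-Solver

    three-branches : ∀ e → n * n ^ e + (n * n ^ e + n ^ k′ * n ^ e) ≤ n ^ (k′ + 3 + e)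
    three-branches e = begin
      n * B + (n * B + n ^ k′ * B)          ≤⟨ +-mono-≤ n≤ (+-mono-≤ n≤ n^k′≤) ⟩
      -- A fourth summand is added because `2 ≤ n` makes four copies fit into the factor `n * n`.
      C + (C + C)                           ≤⟨ +-monoʳ-≤ C (m≤n+m (C + C) C) ⟩
      C + (C + (C + C))                     ≡⟨ solve 1 (λ c → c :+ (c :+ (c :+ c)) := con 2 :* (con 2 :* c)) refl C ⟩
      2 * (2 * C)                           ≤⟨ *-mono-≤ 2≤n (*-monoˡ-≤ C 2≤n) ⟩
      n * (n * C)                           ≡⟨ cong (λ m → n * (n * m)) (sym (^-distribˡ-+-* n (suc k′) e)) ⟩
      n ^ (2 + (suc k′ + e))                ≡⟨ cong (n ^_) (solve 2 (λ k′ e → con 2 :+ (con 1 :+ k′ :+ e) := k′ :+ con 3 :+ e) refl k′ e) ⟩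
      n ^ (k′ + 3 + e)                      ∎
      where
      open ≤-Reasoning
      open +-*-Solver
      B = n ^ e
      C = n ^ suc k′ * n ^ e
      n^k′≤ : n ^ k′ * B ≤ C
      n^k′≤ = *-monoˡ-≤ B (m≤n*m (n ^ k′) n)
      n≤ : n * B ≤ C
      n≤ = *-monoˡ-≤ B (subst (_≤ n ^ suc k′) (*-identityʳ n) (^-monoʳ-≤ n (s≤s (z≤n {k′}))))

    -- j halvings of U are still to be done, each of them in at most K rounds,
    -- of which i are left for the present one.
    rounds : ∀ j i {Z vs ws U ℓ r} → ℓ ∈ˡ vs → r ∈ˡ ws → K * ∣ U ∣ < K * 2 ^ j + i * 2 ^ j →
             AtMost (n ^ cost (j * K + i) (length vs)) (Fits Z vs ws U)
    -- The bound now reads `K * ∣ U ∣ < K`, so `U` is empty and the count by `Y` applies.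
    rounds zero zero {vs = vs} {U = U} ℓ∈vs r∈ws K∣U∣< = fits-atMost U-empty ℓ∈vs r∈ws free
      where
      ∣U∣<1 : ∣ U ∣ < 1
      ∣U∣<1 = *-cancelˡ-< K ∣ U ∣ 1 (subst (K * ∣ U ∣ <_) (+-identityʳ (K * 1)) K∣U∣<)

      U-empty : ∀ {u} → u ∉ U
      U-empty {u} u∈U with ≤-trans (x∈p⇒∣p-x∣<∣p∣ u∈U) (≤-pred ∣U∣<1)
      ... | ()
    -- One halving is complete: `K * 2 ^ suc j` equals `K * 2 ^ j + K * 2 ^ j`, which opens the next
    -- with `K` fresh rounds.
    rounds (suc j) zero {vs = vs} {U = U} ℓ∈vs r∈ws K∣U∣< = atMost-mono
      (≤-reflexive (cong (λ t → n ^ cost t (length vs)) (trans (+-comm (j * K) K) (sym (+-identityʳ (K + j * K))))))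
      (rounds j K ℓ∈vs r∈ws (subst (K * ∣ U ∣ <_) (eq K (2 ^ j)) K∣U∣<))
      where
      eq : ∀ a b → a * (2 * b) + 0 ≡ a * b + a * b
      eq = solve 2 (λ a b → a :* (con 2 :* b) :+ con 0 := a :* b :+ a :* b) refl
        where open +-*-Solver
    rounds j (suc i) {Z} {vs} {ws} {U} {ℓ} ℓ∈vs r∈ws K∣U∣< =
      subst (λ e → AtMost (n ^ e) (Fits Z vs ws U))
        (trans (cost-suc t (length vs)) (cong (λ t → cost t (length vs)) (sym (+-suc (j * K) i))))
        (atMost-mono (three-branches (cost t (suc (length vs))))
          (atMost-map (guess j ℓ)
            (atMost-⊎ (atMost-∃ {P = λ v S → Heavy j U v × Fits Z (v ∷ vs) ws (U ─ N[ v ]) S}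
                        λ v → atMost-given λ heavy → rounds j i (there ℓ∈vs) r∈ws (heavy-decrease v heavy))
            (atMost-⊎ (atMost-∃ {P = λ v S → Heavy j U v × Fits Z vs (v ∷ ws) (U ─ N[ v ]) S}
                        λ v → atMost-given λ heavy → atMost-mono cost-≤ (rounds j i ℓ∈vs (there r∈ws) (heavy-decrease v heavy)))
                      (atMost-∃-length (λ D eq → atMost-mono cost-≤ (rounds j i ℓ∈vs r∈ws (light-decrease D eq))))))))
      where
      t = j * K + i

      cost-≤ : n ^ cost t (length vs) ≤ n ^ cost t (suc (length vs))
      cost-≤ = ^-monoʳ-≤ n (cost-mono {t} ≤-refl (n≤1+n (length vs)))

      -- A heavy vertex takes at least `2 ^ j` from `K * ∣ U ∣`, which pays for one round.
      heavy-decrease : ∀ v → Heavy j U v → K * ∣ U ─ N[ v ] ∣ < K * 2 ^ j + i * 2 ^ j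
      heavy-decrease v heavy = +-cancelˡ-< (2 ^ j) _ _ (begin-strict
        2 ^ j + K * ∣ U ─ N[ v ] ∣                    ≤⟨ +-monoˡ-≤ _ heavy ⟩
        K * ∣ U ∩ N[ v ] ∣ + K * ∣ U ─ N[ v ] ∣       ≡⟨ sym (*-distribˡ-+ K ∣ U ∩ N[ v ] ∣ _) ⟩
        K * (∣ U ∩ N[ v ] ∣ + ∣ U ─ N[ v ] ∣)         ≡⟨ cong (K *_) (∣p∩q∣+∣p─q∣≡∣p∣ U N[ v ]) ⟩
        K * ∣ U ∣                                     <⟨ K∣U∣< ⟩
        K * 2 ^ j + (2 ^ j + i * 2 ^ j)               ≡⟨ solve 3 (λ a b c → a :+ (b :+ c) := b :+ (a :+ c)) refl (K * 2 ^ j) (2 ^ j) (i * 2 ^ j) ⟩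
        2 ^ j + (K * 2 ^ j + i * 2 ^ j)               ∎)
        where
        open ≤-Reasoning
        open +-*-Solver

      -- Since `K` is `suc k′`, what remains is below `K * 2 ^ j`: a light guess completes the
      -- halving whatever `i` is.
      light-decrease : ∀ D → length D ≡ k′ → K * ∣ lightPart j U D ∣ < K * 2 ^ j + i * 2 ^ j
      light-decrease D refl = ≤-trans
        (+-mono-≤ (m^n>0 2 j) (K∣lightPart∣≤ j U D))
        (m≤m+n _ (i * 2 ^ j))

      atMost-∃-length : ∀ {m} {Q : List Vertex → Pred VertexSet 0ℓ} → (∀ D → length D ≡ k′ → AtMost m (Q D)) →
                        AtMost (n ^ k′ * m) (λ S → ∃[ D ] (length D ≡ k′ × Q D S))
      atMost-∃-length h = atMost-map (λ (D , eq , q) → D , eq , eq , q)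
        (atMost-∃-list k′ (λ D → atMost-given (h D)))

    -- Guessing a vertex of each side accounts for the 2 in the exponent. With `U = ⊤`, the
    -- assumption on `n` is the condition for starting halving `j` with all `K` rounds left.
    minimalSeparators-atMost : ∀ j → n < 2 ^ suc j →
      AtMost (n ^ (2 + cost (j * K + K) 1)) (MinimalSeparator G)
    minimalSeparators-atMost j n< = atMost-map ends
      (atMost-∃ {P = λ ℓ S → ∃[ r ] Fits ⊥ (ℓ ∷ []) (r ∷ []) ⊤ S} λ ℓ →
        atMost-∃ {P = λ r → Fits ⊥ (ℓ ∷ []) (r ∷ []) ⊤} λ r →
          rounds j K (here refl) (here refl) K∣⊤∣<)
      where
      ends : ∀ {S} → MinimalSeparator G S → ∃[ ℓ ] ∃[ r ] Fits ⊥ (ℓ ∷ []) (r ∷ []) ⊤ S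
      ends ms with minimalSeparator⇒separation {G = G} ms
      ... | L , R , sep with Separation.L-connected sep | Separation.R-connected sep
      ...   | (ℓ , ℓ∈L) , _ | (r , r∈R) , _ = ℓ , r , record
        { sep = sep ; vs⊆L = ℓ∈L ∷ [] ; ws⊆R = r∈R ∷ []
        ; Z∩L-empty = λ u∈⊥ → contradiction u∈⊥ ∉⊥
        ; Z∩R-empty = λ u∈⊥ → contradiction u∈⊥ ∉⊥
        ; located = λ _ → inj₂ (inj₂ (inj₂ ∈⊤))
        }

      K∣⊤∣< : K * ∣ ⊤ {n} ∣ < K * 2 ^ j + K * 2 ^ j
      K∣⊤∣< = begin-strict
        K * ∣ ⊤ {n} ∣              ≡⟨ cong (K *_) (∣⊤∣≡n n) ⟩
        K * n                      <⟨ *-monoʳ-< K n< ⟩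
        K * (2 * 2 ^ j)            ≡⟨ solve 2 (λ a b → a :* (con 2 :* b) := a :* b :+ a :* b) refl K (2 ^ j) ⟩
        K * 2 ^ j + K * 2 ^ j      ∎
        where
        open ≤-Reasoning
        open +-*-Solver

    cost-linear : ∀ {j} → 1 ≤ j → 2 + cost (j * K + K) 1 ≤ (2 + cost (K + K) 1) * j
    -- The solver verifies an equality after adding the slack, which is `a` times a sum of natural
    -- numbers.
    cost-linear {suc a} _ = m+n≤o⇒m≤o (2 + cost (suc a * K + K) 1) (≤-reflexive (solve 4 (λ a K q k →
      con 2 :+ (((con 1 :+ a) :* K :+ K) :* q :+ (k :+ (((con 1 :+ a) :* K :+ K) :+ con 1) :* con 3))
        :+ a :* (con 5 :+ K :* q :+ k :+ con 3 :* K) :=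
      (con 2 :+ ((K :+ K) :* q :+ (k :+ ((K :+ K) :+ con 1) :* con 3))) :* (con 1 :+ a)) refl a K (k′ + 3) k))
      where open +-*-Solver

-- The logarithmic exponent and its constant

n<2^[1+⌊log₂n⌋] : ∀ n → n < 2 ^ suc ⌊log₂ n ⌋
n<2^[1+⌊log₂n⌋] n = ≰⇒> λ 2^≤n →
  n≮n ⌊log₂ n ⌋ (subst (_≤ ⌊log₂ n ⌋) (⌊log₂[2^n]⌋≡n (suc ⌊log₂ n ⌋)) (⌊log₂⌋-mono-≤ 2^≤n))

-- The two sides are disjoint and non-empty, which provides two distinct vertices.
minimalSeparator⇒2≤order : ∀ {G S} → MinimalSeparator G S → 2 ≤ Graph.order G
minimalSeparator⇒2≤order {G} {S} ms with minimalSeparator⇒separation {G = G} ms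
... | L , R , sep with Separation.L-connected sep | Separation.R-connected sep
...   | (ℓ , ℓ∈L) , _ | (r , r∈R) , _ = distinct {u = ℓ} {r}
  (λ ℓ≡r → Separation.L∩R-empty sep ℓ∈L (subst (_∈ R) (sym ℓ≡r) r∈R))
  where
  distinct : ∀ {n} {u v : Fin n} → u ≢ v → 2 ≤ n
  distinct {suc zero}    {zero} {zero} u≢v = contradiction refl u≢v
  distinct {suc (suc n)} _ = s≤s (s≤s z≤n)

mainTheorem7 : ∀ {ℓ : Level} (F : GraphClass ℓ) → Hereditary F →
    (k k′ : ℕ) →
    (∀ G → F G → CreatureFree G k) →
    (∀ G → F G → SeparatorsDominatedBy G k′) →
    StronglyQuasiTame F
mainTheorem7 F hereditary k k′ free dominated = c , bound
  where
  K = suc k′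

  c : ℕ
  -- This is `2 + cost (K + K) 1`, the exponent for `j = 1`, written out so that it visibly does not
  -- depend on a graph.
  c = 2 + ((K + K) * (k′ + 3) + (k + ((K + K) + 1) * 3))

  bound : ∀ G → F G → let n = Graph.order G in
          1 ≤ n → AtMost (n ^ (c * ⌊log₂ n ⌋)) (MinimalSeparator G)
  bound G G∈F 1≤n []       _   _             = z≤n
  bound G G∈F 1≤n (S ∷ Ss) Ss! mss@(ms ∷ _) = ≤-trans
    (minimalSeparators-atMost G (free G G∈F) dom 2≤n lg (n<2^[1+⌊log₂n⌋] n) (S ∷ Ss) Ss! mss)
    (^-monoʳ-≤ n {{>-nonZero 1≤n}} (cost-linear G (free G G∈F) dom 2≤n (⌊log₂⌋-mono-≤ 2≤n)))
    where
    n = Graph.order G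
    lg = ⌊log₂ n ⌋

    dom : DominatedOutside G k′
    dom = hereditary⇒dominatedOutside hereditary dominated G∈F

    2≤n : 2 ≤ n
    2≤n = minimalSeparator⇒2≤order ms
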